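{- Let $p>3$ be a prime, and for $c,d\in\mathbb{Z}$ let $D_p^-(c,d)=\det\left[(i^2+cij+dj^2)^{p-2}\right]_{1<i,j<p-1}$. Then: (i) if $p\equiv 7\pmod 8$, then $p\mid D_p^-(2,2)$; (ii) if $p>5$ and $p\equiv 2\pmod 3$, then $p\mid D_p^-(3,3)$; (iii) if $p\equiv 3\pmod{20}$ or $p\equiv 7\pmod{20}$, then $p\mid D_p^-(3,1)$.
   Context: For a prime $p>3$ and integers $c,d$, $D_p^-(c,d)$ denotes the determinant of the $(p-3)\times(p-3)$ integer matrix whose rows and columns are indexed by the integers $i,j$ with $1<i<p-1$ and $1<j<p-1$ (that is, $i,j\in\{2,3,\ldots,p-2\}$), and whose $(i,j)$ entry is the integer $(i^2+cij+dj^2)^{p-2}$. -}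

module Defs where

open import Data.Nat.Base using (ℕ; zero; suc; _∸_)
open import Data.Fin.Base using (Fin; zero; suc; toℕ)
open import Data.Integer.Base using (ℤ; +_; 1ℤ; -1ℤ; _+_; _*_; _^_)
open import Data.Integer.Properties using (+-0-commutativeMonoid)
open import Data.Vec.Functional using (Vector; removeAt; tail)
open import Algebra.Properties.CommutativeMonoid.Sum +-0-commutativeMonoid using (sum)

Matrix : ℕ → Set
Matrix n = Vector (Vector ℤ n) n

minor₀ : ∀ {n} → Matrix (suc n) → Fin (suc n) → Matrix n
minor₀ M j r = removeAt (tail M r) j

-- Laplace expansion along row 0.
det : ∀ {n} → Matrix n → ℤ
det {zero}  M = 1ℤ
det {suc n} M = sum λ j → -1ℤ ^ toℕ j * M zero j * det (minor₀ M j)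

entry : ℕ → ℤ → ℤ → ℤ → ℤ → ℤ
entry p c d i j = (i ^ 2 + c * i * j + d * j ^ 2) ^ (p ∸ 2)

-- The Fin indices 0 , … , p ∸ 4 stand for the integers 2 , … , p ∸ 2.
index : ∀ {n} → Fin n → ℤ
index k = + suc (suc (toℕ k))

-- The matrix is intended for p > 3, where both truncated subtractions are exact.
D⁻ : ℕ → ℤ → ℤ → ℤ
D⁻ p c d = det {p ∸ 3} λ i j → entry p c d (index i) (index j)

{-# OPTIONS --safe #-}
module Submission where

-- Modulo p the entry f(i,j) is 1/Q(i,j), where Q(i,j) = i² + c i j + d j² is the norm of i - jρ
-- in 𝔽ₚ[ρ], ρ² + c ρ + d = 0.  In each case the Frobenius map exchanges ρ and its conjugate σ,
-- so Q does not vanish for j ≠ 0.  As the power sums Σᵢ iᵉ vanish for e ≤ p - 2, the moments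
-- T e = Σᵢ (i/j)ᵉ f(i,j) over 0 ≤ i < p satisfy T (e+2) + c T (e+1) + d T e = 0, hence are a linear
-- function of ρᵉ; together with T p = T 1 this makes T e proportional to ρᵉ + σᵉ.  That trace is
-- zero for two exponents a ≠ b of equal parity: 2, 6 in (i), 3, 9 in (ii), (p+1)/4, 3(p+1)/4 in (iii).
-- The weights uᵢ = iᵃ - iᵇ then annihilate every column, and they vanish at i = 0, 1, p - 1,
-- so they form a kernel vector of the submatrix, nonzero since 2ᵃ ≠ 2ᵇ.

open import Defs
open import Algebra.Bundles using (CommutativeSemiring)
open import Algebra.Structures.Biased using (IsCommutativeSemiringˡ; IsCommutativeMonoidˡ)
import Algebra.Properties.CommutativeSemiring.Binomial as Binomial
import Algebra.Properties.CommutativeSemiring.Exp as CExp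
import Algebra.Properties.Semiring.Exp as Exp
import Algebra.Properties.Semiring.Mult as Mult
import Algebra.Properties.Semiring.Sum as Sum
import Algebra.Solver.Ring.NaturalCoefficients.Default as Solver
open import Data.Empty using (⊥-elim)
open import Data.Fin.Base using (Fin; zero; suc; toℕ; fromℕ; inject₁; punchIn)
open import Data.Fin.Properties using (toℕ-fromℕ; toℕ-inject₁; toℕ<n)
open import Data.Integer.Base as ℤ using (ℤ; +_; 0ℤ; 1ℤ; -1ℤ)
import Data.Integer.DivMod as ℤ
open import Data.Integer.Divisibility.Signed using (_∣_)
import Data.Integer.Divisibility.Signed as ℤ
import Data.Integer.Properties as ℤ
open import Data.Integer.Tactic.RingSolver using (solve-∀)
open import Data.Nat.Base as ℕ using (ℕ; zero; suc; _∸_; _<_; _≤_; z<s; s<s; s≤s; _%_; _/_)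
open import Data.Nat.Combinatorics using (_C_; nCk+nC[k+1]≡[n+1]C[k+1]; nCn≡1; nC1≡n)
import Data.Nat.Divisibility as ℕ
open import Data.Nat.DivMod using (m≡m%n+[m/n]*n)
open import Data.Nat.Primality using (Prime; prime?; euclidsLemma; prime⇒nonZero; prime⇒nonTrivial)
import Data.Nat.Properties as ℕ
open import Data.Nat.Tactic.RingSolver using () renaming (solve-∀ to solveℕ-∀)
open import Data.Product.Base using (_×_; _,_; proj₁; proj₂; ∃)
open import Data.Sum.Base using (_⊎_; inj₁; inj₂; [_,_]′)
open import Data.Vec.Functional using (Vector)
open import Function.Base using (_∘_; id)
open import Level using (0ℓ)
open import Relation.Binary.PropositionalEquality as ≡ using (_≡_; _≗_; cong; cong₂; subst)
open import Relation.Binary.Structures using (IsEquivalence)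
open import Relation.Nullary.Decidable using (from-no)
open import Relation.Nullary.Negation using (¬_; contradiction)

-- Quadratic extensions of commutative semirings

-- The pair (x , y) stands for x + y r, where r² = a r + b.
module QuadraticExtension {c ℓ} (A : CommutativeSemiring c ℓ)
  (a b : CommutativeSemiring.Carrier A) where

  open CommutativeSemiring A hiding (zero)
  open Solver A using (solve; _:=_; _:+_; _:*_)

  infix 4 _≋_
  record _≋_ (z w : Carrier × Carrier) : Set ℓ where
    constructor _,_
    field
      ≈₁ : proj₁ z ≈ proj₁ w
      ≈₂ : proj₂ z ≈ proj₂ w
  open _≋_ public

  infixl 6 _⊕_
  infixl 7 _⊗_
  _⊕_ _⊗_ : Carrier × Carrier → Carrier × Carrier → Carrier × Carrier
  (x , y) ⊕ (u , v) = x + u , y + v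
  (x , y) ⊗ (u , v) = x * u + b * (y * v) , x * v + y * u + a * (y * v)

  ≋-isEquivalence : IsEquivalence _≋_
  ≋-isEquivalence = record
    { refl  = refl , refl
    ; sym   = λ (p , q) → sym p , sym q
    ; trans = λ (p , q) (r , s) → trans p r , trans q s
    }

  ⊕-cong : ∀ {z z′ w w′} → z ≋ z′ → w ≋ w′ → z ⊕ w ≋ z′ ⊕ w′
  ⊕-cong (p , q) (r , s) = +-cong p r , +-cong q s

  ⊗-cong : ∀ {z z′ w w′} → z ≋ z′ → w ≋ w′ → z ⊗ w ≋ z′ ⊗ w′
  ⊗-cong (p , q) (r , s) =
    +-cong (*-cong p r) (*-congˡ (*-cong q s)) ,
    +-cong (+-cong (*-cong p s) (*-cong q r)) (*-congˡ (*-cong q s))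

  ⊗-assoc : ∀ z w t → (z ⊗ w) ⊗ t ≋ z ⊗ (w ⊗ t)
  ⊗-assoc (x , y) (u , v) (s , t) =
    solve 8 (λ a b x y u v s t →
      (x :* u :+ b :* (y :* v)) :* s :+ b :* ((x :* v :+ y :* u :+ a :* (y :* v)) :* t) :=
      x :* (u :* s :+ b :* (v :* t)) :+ b :* (y :* (u :* t :+ v :* s :+ a :* (v :* t))))
      refl a b x y u v s t ,
    solve 8 (λ a b x y u v s t →
      (x :* u :+ b :* (y :* v)) :* t :+ (x :* v :+ y :* u :+ a :* (y :* v)) :* s :+ a :* ((x :* v :+ y :* u :+ a :* (y :* v)) :* t) :=
      x :* (u :* t :+ v :* s :+ a :* (v :* t)) :+ y :* (u :* s :+ b :* (v :* t)) :+ a :* (y :* (u :* t :+ v :* s :+ a :* (v :* t))))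
      refl a b x y u v s t

  ⊗-comm : ∀ z w → z ⊗ w ≋ w ⊗ z
  ⊗-comm (x , y) (u , v) =
    solve 5 (λ b x y u v → x :* u :+ b :* (y :* v) := u :* x :+ b :* (v :* y)) refl b x y u v ,
    solve 5 (λ a x y u v → x :* v :+ y :* u :+ a :* (y :* v) := u :* y :+ v :* x :+ a :* (v :* y)) refl a x y u v

  ⊗-identityˡ : ∀ z → (1# , 0#) ⊗ z ≋ z
  ⊗-identityˡ (x , y) =
    trans (+-cong (*-identityˡ x) (trans (*-congˡ (zeroˡ y)) (zeroʳ b))) (+-identityʳ x) ,
    trans (+-cong (trans (+-cong (*-identityˡ y) (zeroˡ x)) (+-identityʳ y)) (trans (*-congˡ (zeroˡ y)) (zeroʳ a))) (+-identityʳ y)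

  ⊗-zeroˡ : ∀ z → (0# , 0#) ⊗ z ≋ (0# , 0#)
  ⊗-zeroˡ (x , y) =
    trans (+-cong (zeroˡ x) (trans (*-congˡ (zeroˡ y)) (zeroʳ b))) (+-identityʳ 0#) ,
    trans (+-cong (trans (+-cong (zeroˡ y) (zeroˡ x)) (+-identityʳ 0#)) (trans (*-congˡ (zeroˡ y)) (zeroʳ a))) (+-identityʳ 0#)

  ⊗-distribʳ-⊕ : ∀ z w t → (w ⊕ t) ⊗ z ≋ (w ⊗ z) ⊕ (t ⊗ z)
  ⊗-distribʳ-⊕ (x , y) (u , v) (s , t) =
    solve 7 (λ b x y u v s t →
      (u :+ s) :* x :+ b :* ((v :+ t) :* y) :=
      (u :* x :+ b :* (v :* y)) :+ (s :* x :+ b :* (t :* y)))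
      refl b x y u v s t ,
    solve 7 (λ a x y u v s t →
      (u :+ s) :* y :+ (v :+ t) :* x :+ a :* ((v :+ t) :* y) :=
      (u :* y :+ v :* x :+ a :* (v :* y)) :+ (s :* y :+ t :* x :+ a :* (t :* y)))
      refl a x y u v s t

  commutativeSemiring : CommutativeSemiring c ℓ
  commutativeSemiring = record
    { Carrier = Carrier × Carrier
    ; _≈_ = _≋_
    ; _+_ = _⊕_
    ; _*_ = _⊗_
    ; 0#  = 0# , 0#
    ; 1#  = 1# , 0#
    ; isCommutativeSemiring = IsCommutativeSemiringˡ.isCommutativeSemiring record
      { +-isCommutativeMonoid = IsCommutativeMonoidˡ.isCommutativeMonoid record
        { isSemigroup = record
          { isMagma = record { isEquivalence = ≋-isEquivalence ; ∙-cong = ⊕-cong }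
          ; assoc = λ _ _ _ → +-assoc _ _ _ , +-assoc _ _ _
          }
        ; identityˡ = λ _ → +-identityˡ _ , +-identityˡ _
        ; comm = λ _ _ → +-comm _ _ , +-comm _ _
        }
      ; *-isCommutativeMonoid = IsCommutativeMonoidˡ.isCommutativeMonoid record
        { isSemigroup = record
          { isMagma = record { isEquivalence = ≋-isEquivalence ; ∙-cong = ⊗-cong }
          ; assoc = ⊗-assoc
          }
        ; identityˡ = ⊗-identityˡ
        ; comm = ⊗-comm
        }
      ; distribʳ = ⊗-distribʳ-⊕
      ; zeroˡ = ⊗-zeroˡ
      }
    }

  private
    module M = Mult semiring
    module M′ = Mult (CommutativeSemiring.semiring commutativeSemiring)
    open Exp semiring using (_^_)
    module E′ = Exp (CommutativeSemiring.semiring commutativeSemiring)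

  -- Lets characteristic `p` pass from the base to the extension, as `Frobenius` requires.
  ×-pair : ∀ n z → n M′.× z ≡ (n M.× proj₁ z , n M.× proj₂ z)
  ×-pair zero    z = ≡.refl
  ×-pair (suc n) z = ≡.cong (z ⊕_) (×-pair n z)

  ι : Carrier → Carrier × Carrier
  ι x = x , 0#

  ι-cong : ∀ {x y} → x ≈ y → ι x ≋ ι y
  ι-cong x≈y = x≈y , refl

  ι-* : ∀ x y → ι x ⊗ ι y ≋ ι (x * y)
  ι-* x y =
    trans (+-congˡ (trans (*-congˡ (zeroˡ 0#)) (zeroʳ b))) (+-identityʳ _) ,
    trans (+-cong (trans (+-cong (zeroʳ x) (zeroˡ y)) (+-identityʳ 0#)) (trans (*-congˡ (zeroˡ 0#)) (zeroʳ a))) (+-identityʳ 0#)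

  ι-^ : ∀ x n → ι x E′.^ n ≋ ι (x ^ n)
  ι-^ x zero    = refl , refl
  ι-^ x (suc n) = IsEquivalence.trans ≋-isEquivalence
    (⊗-cong (refl , refl) (ι-^ x n)) (ι-* x (x ^ n))

-- Powers of roots of unity

module _ {c ℓ} (A : CommutativeSemiring c ℓ) where
  open CommutativeSemiring A hiding (zero)
  open Exp semiring

  1^n≈1 : ∀ n → 1# ^ n ≈ 1#
  1^n≈1 zero    = refl
  1^n≈1 (suc n) = trans (*-identityˡ _) (1^n≈1 n)

  ^-periodic : ∀ {x n} → x ^ n ≈ 1# → ∀ r k → x ^ (r ℕ.+ k ℕ.* n) ≈ x ^ r
  ^-periodic {x} {n} x^n≈1 r k = begin
    x ^ (r ℕ.+ k ℕ.* n)     ≈⟨ ^-homo-* x r (k ℕ.* n) ⟩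
    x ^ r * x ^ (k ℕ.* n)   ≡⟨ cong (λ l → x ^ r * x ^ l) (ℕ.*-comm k n) ⟩
    x ^ r * x ^ (n ℕ.* k)   ≈⟨ *-congˡ (^-assocʳ x n k) ⟨
    x ^ r * (x ^ n) ^ k     ≈⟨ *-congˡ (trans (^-congˡ k x^n≈1) (1^n≈1 k)) ⟩
    x ^ r * 1#              ≈⟨ *-identityʳ _ ⟩
    x ^ r                   ∎
    where open import Relation.Binary.Reasoning.Setoid setoid

  -- Used to evaluate the `p`-th power of a root of unity from the residue of `p` modulo its order.
  ^-mod : ∀ {p} x {y} n r k → p ≡ r ℕ.+ k ℕ.* n → x ^ n ≈ 1# → x ^ r ≈ y → x ^ p ≈ y
  ^-mod x n r k ≡.refl x^n≈1 x^r≈y = trans (^-periodic x^n≈1 r k) x^r≈y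

-- Binomial coefficients and the Frobenius map

-- The absorption identity, by induction along Pascal's rule.
[1+k]*[1+n]C[1+k]≡[1+n]*nCk : ∀ n k → suc k ℕ.* (suc n C suc k) ≡ suc n ℕ.* (n C k)
[1+k]*[1+n]C[1+k]≡[1+n]*nCk n zero = ≡.trans (ℕ.*-identityˡ (suc n C 1)) (≡.trans (nC1≡n (suc n)) (≡.sym (ℕ.*-identityʳ (suc n))))
[1+k]*[1+n]C[1+k]≡[1+n]*nCk zero (suc k) = ℕ.*-zeroʳ k
[1+k]*[1+n]C[1+k]≡[1+n]*nCk (suc n) (suc k) = begin
  suc (suc k) ℕ.* (suc (suc n) C suc (suc k))
    ≡⟨ cong (suc (suc k) ℕ.*_) (nCk+nC[k+1]≡[n+1]C[k+1] (suc n) (suc k)) ⟨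
  suc (suc k) ℕ.* ((suc n C suc k) ℕ.+ (suc n C suc (suc k)))
    ≡⟨ split (suc k) (suc n C suc k) (suc n C suc (suc k)) ⟩
  (suc n C suc k) ℕ.+ suc k ℕ.* (suc n C suc k) ℕ.+ suc (suc k) ℕ.* (suc n C suc (suc k))
    ≡⟨ cong₂ (λ x y → (suc n C suc k) ℕ.+ x ℕ.+ y) ([1+k]*[1+n]C[1+k]≡[1+n]*nCk n k) ([1+k]*[1+n]C[1+k]≡[1+n]*nCk n (suc k)) ⟩
  (suc n C suc k) ℕ.+ suc n ℕ.* (n C k) ℕ.+ suc n ℕ.* (n C suc k)
    ≡⟨ merge (suc n) (suc n C suc k) (n C k) (n C suc k) ⟩
  (suc n C suc k) ℕ.+ suc n ℕ.* ((n C k) ℕ.+ (n C suc k))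
    ≡⟨ cong (λ x → (suc n C suc k) ℕ.+ suc n ℕ.* x) (nCk+nC[k+1]≡[n+1]C[k+1] n k) ⟩
  suc (suc n) ℕ.* (suc n C suc k) ∎
  where
  open ≡.≡-Reasoning
  split : ∀ k x y → suc k ℕ.* (x ℕ.+ y) ≡ x ℕ.+ k ℕ.* x ℕ.+ suc k ℕ.* y
  split = solveℕ-∀
  merge : ∀ n x y z → x ℕ.+ n ℕ.* y ℕ.+ n ℕ.* z ≡ x ℕ.+ n ℕ.* (y ℕ.+ z)
  merge = solveℕ-∀

-- Adding `n C k` to both sides turns this into absorption. It expands multiplication by `n` in the
-- binomial basis, which drives the induction for power sums.
n*nCk≡[1+k]*nC[1+k]+k*nCk : ∀ n k → n ℕ.* (n C k) ≡ suc k ℕ.* (n C suc k) ℕ.+ k ℕ.* (n C k)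
n*nCk≡[1+k]*nC[1+k]+k*nCk n k = ℕ.+-cancelˡ-≡ (n C k) _ _ (begin
  suc n ℕ.* (n C k)                                        ≡⟨ [1+k]*[1+n]C[1+k]≡[1+n]*nCk n k ⟨
  suc k ℕ.* (suc n C suc k)                                ≡⟨ cong (suc k ℕ.*_) (nCk+nC[k+1]≡[n+1]C[k+1] n k) ⟨
  suc k ℕ.* ((n C k) ℕ.+ (n C suc k))                      ≡⟨ expand k (n C k) (n C suc k) ⟩
  (n C k) ℕ.+ (suc k ℕ.* (n C suc k) ℕ.+ k ℕ.* (n C k))    ∎)
  where
  open ≡.≡-Reasoning
  expand : ∀ k x y → suc k ℕ.* (x ℕ.+ y) ≡ x ℕ.+ (suc k ℕ.* y ℕ.+ k ℕ.* x)
  expand = solveℕ-∀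

-- By absorption `p` divides `suc k` times the coefficient, and `suc k` is too small to be divisible
-- by `p`.
prime∣pC : ∀ {p} → Prime p → ∀ k → suc k < p → p ℕ.∣ (p C suc k)
prime∣pC {suc m} pr k 1+k<p = [ ⊥-elim ∘ ℕ.>⇒∤ 1+k<p , id ]′ (euclidsLemma (suc k) (suc m C suc k) pr
  (subst (suc m ℕ.∣_) (≡.sym ([1+k]*[1+n]C[1+k]≡[1+n]*nCk m k)) (ℕ.m∣m*n (m C k))))

-- Stated for any commutative semiring of characteristic `p`, because it is applied to the integers
-- modulo `p`, to a quadratic extension of them, and to a quadratic extension of that.
module Frobenius {c ℓ} (A : CommutativeSemiring c ℓ) {p} (p-prime : Prime p)
  (p×≈0 : ∀ x → CommutativeSemiring._≈_ A (Mult._×_ (CommutativeSemiring.semiring A) p x) (CommutativeSemiring.0# A))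
  where

  open CommutativeSemiring A hiding (zero)
  open Mult semiring using () renaming (_×_ to infixr 8 _·_)
  open Exp semiring
  open Mult semiring using (×-assocˡ; ×-cong; ×-homo-1)
  open Sum semiring using (sum; sum-cong-≋; sum-replicate-zero; sum-init-last)
  open import Relation.Binary.Reasoning.Setoid setoid

  ∣⇒×≈0 : ∀ {n} → p ℕ.∣ n → ∀ x → n · x ≈ 0#
  ∣⇒×≈0 (ℕ.divides q ≡.refl) x = begin
    (q ℕ.* p) · x   ≈⟨ ×-cong (ℕ.*-comm q p) refl ⟩
    (p ℕ.* q) · x   ≈⟨ ×-assocˡ x p q ⟨
    p · (q · x)     ≈⟨ p×≈0 (q · x) ⟩
    0#              ∎

  frobenius : ∀ x y → (x + y) ^ p ≈ x ^ p + y ^ p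
  frobenius x y = go p ≡.refl
    where
    -- Putting a variable in place of `p` allows matching it as `suc m`, so that the two outer
    -- binomial terms split off.
    go : ∀ n → n ≡ p → (x + y) ^ n ≈ x ^ n + y ^ n
    go zero    ≡.refl with () ← prime⇒nonZero p-prime
    go (suc m) ≡.refl = begin
      (x + y) ^ suc m                                ≈⟨ Binomial.theorem A (suc m) x y ⟩
      term zero + sum (term ∘ suc)                   ≈⟨ +-congˡ (sum-init-last (term ∘ suc)) ⟩
      term zero + (sum (term ∘ suc ∘ inject₁) + term (suc (fromℕ m)))
        ≈⟨ +-cong first (+-cong middle (last (toℕ-fromℕ m))) ⟩
      y ^ suc m + (0# + x ^ suc m)                   ≈⟨ +-congˡ (+-identityˡ _) ⟩
      y ^ suc m + x ^ suc m                          ≈⟨ +-comm _ _ ⟩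
      x ^ suc m + y ^ suc m                          ∎
      where
      term : Fin (suc (suc m)) → Carrier
      term = Binomial.binomialTerm A x y (suc m)
      first : term zero ≈ y ^ suc m
      first = trans (×-homo-1 _) (*-identityˡ _)
      last : ∀ {k} → k ≡ m → (suc m C suc k) · (x ^ suc k * y ^ (m ∸ k)) ≈ x ^ suc m
      last ≡.refl = begin
        (suc m C suc m) · (x ^ suc m * y ^ (m ∸ m))   ≈⟨ ×-cong (nCn≡1 (suc m)) (*-congˡ (^-congʳ y (ℕ.n∸n≡0 m))) ⟩
        1 · (x ^ suc m * 1#)                          ≈⟨ ×-homo-1 _ ⟩
        x ^ suc m * 1#                                ≈⟨ *-identityʳ _ ⟩
        x ^ suc m                                     ∎
      middle : sum (term ∘ suc ∘ inject₁) ≈ 0#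
      middle = trans
        (sum-cong-≋ {m} λ i → ∣⇒×≈0 (prime∣pC p-prime (toℕ (inject₁ i)) (s<s (subst (_< m) (≡.sym (toℕ-inject₁ i)) (toℕ<n i)))) _)
        (sum-replicate-zero m)

open import Data.Integer.Base using (_+_; _*_; _-_; -_; _^_)
open import Relation.Binary.PropositionalEquality using (refl)

private module ∑ = Sum (CommutativeSemiring.semiring ℤ.+-*-commutativeSemiring)

-- Determinants

-- The alternating sum v₀ - v₁ + v₂ - ..., with the Laplace signs built into the recursion.
alt : ∀ {n} → Vector ℤ n → ℤ
alt {zero}  v = 0ℤ
alt {suc n} v = v zero - alt (v ∘ suc)

alt-cong : ∀ {n} {v w : Vector ℤ n} → v ≗ w → alt v ≡ alt w
alt-cong {zero}  v≗w = refl
alt-cong {suc n} v≗w = cong₂ _-_ (v≗w zero) (alt-cong (v≗w ∘ suc))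

alt-+ : ∀ {n} (v w : Vector ℤ n) → alt (λ j → v j + w j) ≡ alt v + alt w
alt-+ {zero}  v w = refl
alt-+ {suc n} v w = ≡.trans (cong (_-_ (v zero + w zero)) (alt-+ (v ∘ suc) (w ∘ suc)))
  (regroup (v zero) (w zero) (alt (v ∘ suc)) (alt (w ∘ suc)))
  where
  regroup : ∀ a b x y → a + b - (x + y) ≡ (a - x) + (b - y)
  regroup = solve-∀

alt-* : ∀ {n} a (v : Vector ℤ n) → alt (λ j → a * v j) ≡ a * alt v
alt-* {zero}  a v = ≡.sym (ℤ.*-zeroʳ a)
alt-* {suc n} a v = ≡.trans (cong (_-_ (a * v zero)) (alt-* a (v ∘ suc))) (distrib a (v zero) (alt (v ∘ suc)))
  where
  distrib : ∀ a x y → a * x - a * y ≡ a * (x - y)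
  distrib = solve-∀

alt-zero : ∀ {n} {v : Vector ℤ n} → (∀ j → v j ≡ 0ℤ) → alt v ≡ 0ℤ
alt-zero {n} {v} v≡0 = ≡.trans (alt-cong v≡0) (alt-* {n} 0ℤ (λ _ → 0ℤ))

sum≡alt : ∀ {n} (v : Vector ℤ n) → ∑.sum (λ j → -1ℤ ^ toℕ j * v j) ≡ alt v
sum≡alt {zero}  v = refl
sum≡alt {suc n} v = cong₂ _+_ (ℤ.*-identityˡ (v zero)) (begin
  ∑.sum (λ j → -1ℤ * -1ℤ ^ toℕ j * v (suc j))    ≡⟨ ∑.sum-cong-≗ {n} (λ j → ℤ.*-assoc -1ℤ (-1ℤ ^ toℕ j) (v (suc j))) ⟩
  ∑.sum (λ j → -1ℤ * (-1ℤ ^ toℕ j * v (suc j)))  ≡⟨ ∑.*-distribˡ-sum {n} -1ℤ (λ j → -1ℤ ^ toℕ j * v (suc j)) ⟨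
  -1ℤ * ∑.sum (λ j → -1ℤ ^ toℕ j * v (suc j))    ≡⟨ ℤ.-1*i≡-i _ ⟩
  - ∑.sum (λ j → -1ℤ ^ toℕ j * v (suc j))        ≡⟨ cong -_ (sum≡alt (v ∘ suc)) ⟩
  - alt (v ∘ suc)                                ∎)
  where open ≡.≡-Reasoning

det≡alt : ∀ {n} (M : Matrix (suc n)) → det M ≡ alt (λ j → M zero j * det (minor₀ M j))
det≡alt {n} M = ≡.trans
  (∑.sum-cong-≗ {suc n} (λ j → ℤ.*-assoc (-1ℤ ^ toℕ j) (M zero j) (det (minor₀ M j))))
  (sum≡alt (λ j → M zero j * det (minor₀ M j)))

det-cong : ∀ {n} {M N : Matrix n} → (∀ i → M i ≗ N i) → det M ≡ det N
det-cong {zero}  M≗N = refl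
det-cong {suc n} M≗N = ∑.sum-cong-≗ {suc n} λ j →
  cong₂ (λ x y → -1ℤ ^ toℕ j * x * y) (M≗N zero j) (det-cong (λ i → M≗N (suc i) ∘ punchIn j))

-- A quantity depending on a selection of `m` out of `n` columns, such as a minor.
Functional : ℕ → ℕ → Set
Functional m n = (Fin m → Fin n) → ℤ

-- Different composites of `punchIn` agree only pointwise, so invariance under `≗` is carried as a
-- hypothesis.
Extensional : ∀ {m n} → Functional m n → Set
Extensional D = ∀ e e′ → e ≗ e′ → D e ≡ D e′

lift₁ : ∀ {m n} → (Fin m → Fin n) → Fin (suc m) → Fin (suc n)
lift₁ e zero    = zero
lift₁ e (suc i) = suc (e i)

-- Laplace expansion along two rows at once: `x j l` stands for the product of their entries in
-- columns `j` and `l`, and `D` for the minor on the other columns.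
altAlt : ∀ {n} → (Fin (suc (suc n)) → Fin (suc (suc n)) → ℤ) → Functional n (suc (suc n)) → ℤ
altAlt x D = alt λ j → alt λ k → x j (punchIn j k) * D (punchIn j ∘ punchIn k)

-- In the iterated alternating sum the two orders of deleting a pair of columns
-- come with opposite signs.
altAlt-symmetric : ∀ {n} {x : Fin (suc (suc n)) → Fin (suc (suc n)) → ℤ} {D : Functional n (suc (suc n))} →
  (∀ j l → x j l ≡ x l j) → Extensional D → altAlt x D ≡ 0ℤ
altAlt-symmetric {zero} {x} {D} x-sym D-ext = ≡.trans
  (cong₂ (λ y z → (y * D first - 0ℤ) - (x (suc zero) zero * z - 0ℤ - 0ℤ)) (x-sym zero (suc zero)) (D-ext second first λ ()))
  (cancel (x (suc zero) zero * D first))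
  where
  first second : Fin 0 → Fin 2
  first = punchIn zero ∘ punchIn zero
  second = punchIn (suc zero) ∘ punchIn zero
  cancel : ∀ y → (y - 0ℤ) - (y - 0ℤ - 0ℤ) ≡ 0ℤ
  cancel = solve-∀
altAlt-symmetric {suc n} {x} {D} x-sym D-ext = begin
  alt first - alt (λ j → second j - alt (rest j))              ≡⟨ cong (_-_ (alt first)) (begin
    alt (λ j → second j - alt (rest j))                          ≡⟨ alt-cong (λ j → cong (_+_ (second j)) (≡.sym (ℤ.-1*i≡-i (alt (rest j))))) ⟩
    alt (λ j → second j + -1ℤ * alt (rest j))                    ≡⟨ alt-+ second (λ j → -1ℤ * alt (rest j)) ⟩
    alt second + alt (λ j → -1ℤ * alt (rest j))                  ≡⟨ cong (_+_ (alt second)) (alt-* -1ℤ (alt ∘ rest)) ⟩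
    alt second + -1ℤ * alt (alt ∘ rest)                          ≡⟨ cong₂ (λ y z → y + -1ℤ * z) (≡.sym first≡second) rest≡0 ⟩
    alt first + -1ℤ * 0ℤ                                         ≡⟨ ℤ.+-identityʳ _ ⟩
    alt first                                                    ∎) ⟩
  alt first - alt first                                        ≡⟨ ℤ.+-inverseʳ (alt first) ⟩
  0ℤ                                                           ∎
  where
  open ≡.≡-Reasoning
  -- `first` collects the pairs that delete column 0 first, `second` those that delete it second;
  -- they cancel by symmetry. In `rest` column 0 survives, and `lift₁` reduces to the remaining
  -- columns.
  first : Fin (suc (suc n)) → ℤ
  first k = x zero (suc k) * D (suc ∘ punchIn k)
  second : Fin (suc (suc n)) → ℤ
  second j = x (suc j) zero * D (punchIn (suc j) ∘ suc)
  rest : Fin (suc (suc n)) → Fin (suc n) → ℤ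
  rest j k = x (suc j) (suc (punchIn j k)) * D (punchIn (suc j) ∘ punchIn (suc k))
  first≡second : alt first ≡ alt second
  first≡second = alt-cong λ k → cong (_* D (suc ∘ punchIn k)) (x-sym zero (suc k))
  rest≡0 : alt (alt ∘ rest) ≡ 0ℤ
  rest≡0 = ≡.trans
    (alt-cong λ j → alt-cong λ k → cong (x (suc j) (suc (punchIn j k)) *_)
      (D-ext (punchIn (suc j) ∘ punchIn (suc k)) (lift₁ (punchIn j ∘ punchIn k))
        λ { zero → refl ; (suc i) → refl }))
    (altAlt-symmetric {x = λ j l → x (suc j) (suc l)} {D = D ∘ lift₁}
      (λ j l → x-sym (suc j) (suc l))
      (λ e e′ e≗e′ → D-ext (lift₁ e) (lift₁ e′) λ { zero → refl ; (suc i) → cong suc (e≗e′ i) }))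

altAlt-+ : ∀ {n} (x y : Fin (suc (suc n)) → Fin (suc (suc n)) → ℤ) (D : Functional n (suc (suc n))) →
  altAlt (λ j l → x j l + y j l) D ≡ altAlt x D + altAlt y D
altAlt-+ x y D = ≡.trans
  (alt-cong λ j → ≡.trans (alt-cong λ k → ℤ.*-distribʳ-+ (D (punchIn j ∘ punchIn k)) (x j (punchIn j k)) (y j (punchIn j k)))
    (alt-+ (λ k → x j (punchIn j k) * D (punchIn j ∘ punchIn k)) (λ k → y j (punchIn j k) * D (punchIn j ∘ punchIn k))))
  (alt-+ (λ j → alt λ k → x j (punchIn j k) * D (punchIn j ∘ punchIn k)) (λ j → alt λ k → y j (punchIn j k) * D (punchIn j ∘ punchIn k)))

lowerMinor : ∀ {n} → Matrix (suc (suc n)) → Functional n (suc (suc n))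
lowerMinor M e = det λ r → M (suc (suc r)) ∘ e

det≡altAlt : ∀ {n} (M : Matrix (suc (suc n))) →
  det M ≡ altAlt (λ j l → M zero j * M (suc zero) l) (lowerMinor M)
det≡altAlt M = ≡.trans (det≡alt M) (alt-cong λ j → begin
  M zero j * det (minor₀ M j)
    ≡⟨ cong (M zero j *_) (det≡alt (minor₀ M j)) ⟩
  M zero j * alt (λ k → M (suc zero) (punchIn j k) * lowerMinor M (punchIn j ∘ punchIn k))
    ≡⟨ alt-* (M zero j) (λ k → M (suc zero) (punchIn j k) * lowerMinor M (punchIn j ∘ punchIn k)) ⟨
  alt (λ k → M zero j * (M (suc zero) (punchIn j k) * lowerMinor M (punchIn j ∘ punchIn k)))
    ≡⟨ alt-cong (λ k → ℤ.*-assoc (M zero j) (M (suc zero) (punchIn j k)) (lowerMinor M (punchIn j ∘ punchIn k))) ⟨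
  alt (λ k → M zero j * M (suc zero) (punchIn j k) * lowerMinor M (punchIn j ∘ punchIn k))
    ∎)
  where open ≡.≡-Reasoning

lowerMinor-ext : ∀ {n} (M : Matrix (suc (suc n))) → Extensional (lowerMinor M)
lowerMinor-ext M e e′ e≗e′ = det-cong λ r c → cong (M (suc (suc r))) (e≗e′ c)

swap₀₁ : ∀ {n} → Matrix (suc (suc n)) → Matrix (suc (suc n))
swap₀₁ M zero          = M (suc zero)
swap₀₁ M (suc zero)    = M zero
swap₀₁ M (suc (suc r)) = M (suc (suc r))

-- The two double expansions share their lower minors, and their coefficients add up to a function
-- symmetric in the two columns.
det-swap₀₁ : ∀ {n} (M : Matrix (suc (suc n))) → det M + det (swap₀₁ M) ≡ 0ℤ
det-swap₀₁ M = begin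
  det M + det (swap₀₁ M)                                ≡⟨ cong₂ _+_ (det≡altAlt M) (det≡altAlt (swap₀₁ M)) ⟩
  altAlt x (lowerMinor M) + altAlt y (lowerMinor M)     ≡⟨ altAlt-+ x y (lowerMinor M) ⟨
  altAlt (λ j l → x j l + y j l) (lowerMinor M)         ≡⟨ altAlt-symmetric {x = λ j l → x j l + y j l} x+y-sym (lowerMinor-ext M) ⟩
  0ℤ                                                    ∎
  where
  open ≡.≡-Reasoning
  x y : _ → _ → ℤ
  x j l = M zero j * M (suc zero) l
  y j l = M (suc zero) j * M zero l
  x+y-sym : ∀ j l → x j l + y j l ≡ x l j + y l j
  x+y-sym j l = comm (M zero j) (M (suc zero) l) (M (suc zero) j) (M zero l)
    where
    comm : ∀ a b c d → a * b + c * d ≡ d * c + b * a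
    comm = solve-∀

-- If row 1 repeats row 0, the coefficients of the double expansion are symmetric. Otherwise rows 0
-- and 1 are swapped, and each minor below the new top row vanishes by induction.
det-repeatedRow : ∀ {n} (M : Matrix (suc n)) i → M zero ≗ M (suc i) → det M ≡ 0ℤ
det-repeatedRow {suc n} M zero eq = ≡.trans (det≡altAlt M)
  (altAlt-symmetric {x = λ j l → M zero j * M (suc zero) l} rows-sym (lowerMinor-ext M))
  where
  rows-sym : ∀ j l → M zero j * M (suc zero) l ≡ M zero l * M (suc zero) j
  rows-sym j l = ≡.trans (cong₂ _*_ (eq j) (≡.sym (eq l))) (ℤ.*-comm (M (suc zero) j) (M zero l))
det-repeatedRow {suc n} M (suc i) eq = begin
  det M                      ≡⟨ ℤ.+-identityʳ (det M) ⟨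
  det M + 0ℤ                 ≡⟨ cong (_+_ (det M)) swapped≡0 ⟨
  det M + det (swap₀₁ M)     ≡⟨ det-swap₀₁ M ⟩
  0ℤ                         ∎
  where
  open ≡.≡-Reasoning
  swapped≡0 : det (swap₀₁ M) ≡ 0ℤ
  swapped≡0 = ≡.trans (det≡alt (swap₀₁ M)) (alt-zero λ j → ≡.trans
    (cong (M (suc zero) j *_) (det-repeatedRow (minor₀ (swap₀₁ M) j) i (eq ∘ punchIn j)))
    (ℤ.*-zeroʳ (M (suc zero) j)))

alt-∑ : ∀ {m n} (u : Vector ℤ m) (N : Fin m → Vector ℤ n) (w : Vector ℤ n) →
  alt (λ j → ∑.sum (λ i → u i * N i j) * w j) ≡ ∑.sum (λ i → u i * alt (λ j → N i j * w j))
alt-∑ {zero}  u N w = alt-zero λ j → ℤ.*-zeroˡ (w j)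
alt-∑ {suc m} u N w = begin
  alt (λ j → (u zero * N zero j + S j) * w j)                ≡⟨ alt-cong (λ j → distrib (u zero) (N zero j) (S j) (w j)) ⟩
  alt (λ j → u zero * (N zero j * w j) + S j * w j)          ≡⟨ alt-+ (λ j → u zero * (N zero j * w j)) (λ j → S j * w j) ⟩
  alt (λ j → u zero * (N zero j * w j)) + alt (λ j → S j * w j)
    ≡⟨ cong₂ _+_ (alt-* (u zero) (λ j → N zero j * w j)) (alt-∑ (u ∘ suc) (N ∘ suc) w) ⟩
  ∑.sum (λ i → u i * alt (λ j → N i j * w j))                ∎
  where
  open ≡.≡-Reasoning
  S : Vector ℤ _
  S j = ∑.sum (λ i → u (suc i) * N (suc i) j)
  distrib : ∀ a b c d → (a * b + c) * d ≡ a * (b * d) + c * d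
  distrib = solve-∀

-- The right side expands the determinant with row 0 replaced by the combination Σ uᵢ Mᵢ; every row
-- other than row 0 contributes a determinant with a repeated row. Hence a kernel vector modulo `p`
-- whose coordinate 0 is a unit forces the determinant to vanish modulo `p`.
row₀*det : ∀ {n} (M : Matrix (suc n)) (u : Vector ℤ (suc n)) →
  u zero * det M ≡ alt (λ j → ∑.sum (λ i → u i * M i j) * det (minor₀ M j))
row₀*det {n} M u = begin
  u zero * det M                                              ≡⟨ cong (u zero *_) (det≡alt M) ⟩
  u zero * expand zero                                        ≡⟨ ℤ.+-identityʳ _ ⟨
  u zero * expand zero + 0ℤ                                   ≡⟨ cong (_+_ (u zero * expand zero)) others≡0 ⟨
  ∑.sum (λ i → u i * expand i)                                ≡⟨ alt-∑ u M (det ∘ minor₀ M) ⟨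
  alt (λ j → ∑.sum (λ i → u i * M i j) * det (minor₀ M j))    ∎
  where
  open ≡.≡-Reasoning
  expand : Fin (suc n) → ℤ
  expand i = alt (λ j → M i j * det (minor₀ M j))
  repeatRow : Fin n → Matrix (suc n)
  repeatRow i zero    = M (suc i)
  repeatRow i (suc r) = M (suc r)
  others≡0 : ∑.sum (λ i → u (suc i) * expand (suc i)) ≡ 0ℤ
  others≡0 = ≡.trans
    (∑.sum-cong-≗ {n} λ i → ≡.trans
      (cong (u (suc i) *_) (≡.trans (≡.sym (det≡alt (repeatRow i))) (det-repeatedRow (repeatRow i) i (λ _ → refl))))
      (ℤ.*-zeroʳ (u (suc i))))
    (∑.sum-replicate-zero n)

-- Integers modulo p

sum-toℕ-suc : ∀ n (f : ℕ → ℤ) → ∑.sum {suc n} (f ∘ toℕ) ≡ ∑.sum {n} (f ∘ toℕ) + f n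
sum-toℕ-suc n f = ≡.trans (∑.sum-init-last {n} (f ∘ toℕ))
  (cong₂ _+_ (∑.sum-cong-≗ {n} (cong f ∘ toℕ-inject₁)) (cong f (toℕ-fromℕ n)))

hockeyStick : ∀ n k → ∑.sum {n} (λ i → + (toℕ i C k)) ≡ + (n C suc k)
hockeyStick zero    k = refl
hockeyStick (suc n) k = begin
  ∑.sum {suc n} (λ i → + (toℕ i C k))           ≡⟨ sum-toℕ-suc n (λ i → + (i C k)) ⟩
  ∑.sum {n} (λ i → + (toℕ i C k)) + + (n C k)   ≡⟨ cong (_+ + (n C k)) (hockeyStick n k) ⟩
  + ((n C suc k) ℕ.+ (n C k))                   ≡⟨ cong +_ (≡.trans (ℕ.+-comm (n C suc k) (n C k)) (nCk+nC[k+1]≡[n+1]C[k+1] n k)) ⟩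
  + (suc n C suc k)                             ∎
  where open ≡.≡-Reasoning

module Modular (p : ℕ) where

  infix 4 _≈_
  -- A record, so that `x` and `y` can be inferred from the type; the bare difference would not
  -- determine them.
  record _≈_ (x y : ℤ) : Set where
    constructor mk≈
    field divides-difference : + p ℤ.∣ x - y
  open _≈_ public

  ≡⇒≈ : ∀ {x y} → x ≡ y → x ≈ y
  ≡⇒≈ {x} refl = mk≈ (ℤ.divides 0ℤ (ℤ.+-inverseʳ x))

  ≈-refl : ∀ {x} → x ≈ x
  ≈-refl = ≡⇒≈ refl

  ≈-trans : ∀ {x y z} → x ≈ y → y ≈ z → x ≈ z
  ≈-trans {x} {y} {z} (mk≈ d) (mk≈ e) = mk≈ (subst (+ p ℤ.∣_) (telescope x y z) (ℤ.∣m∣n⇒∣m+n d e))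
    where
    telescope : ∀ x y z → (x - y) + (y - z) ≡ x - z
    telescope = solve-∀

  ≈-sym : ∀ {x y} → x ≈ y → y ≈ x
  ≈-sym {x} {y} (mk≈ d) = mk≈ (subst (+ p ℤ.∣_) (swap x y) (ℤ.∣m⇒∣-m d))
    where
    swap : ∀ x y → - (x - y) ≡ y - x
    swap = solve-∀

  +-cong : ∀ {x x′ y y′} → x ≈ x′ → y ≈ y′ → x + y ≈ x′ + y′
  +-cong {x} {x′} {y} {y′} (mk≈ d) (mk≈ e) = mk≈ (subst (+ p ℤ.∣_) (regroup x x′ y y′) (ℤ.∣m∣n⇒∣m+n d e))
    where
    regroup : ∀ x x′ y y′ → (x - x′) + (y - y′) ≡ (x + y) - (x′ + y′)
    regroup = solve-∀

  *-cong : ∀ {x x′ y y′} → x ≈ x′ → y ≈ y′ → x * y ≈ x′ * y′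
  *-cong {x} {x′} {y} {y′} (mk≈ d) (mk≈ e) = mk≈ (subst (+ p ℤ.∣_) (regroup x x′ y y′)
    (ℤ.∣m∣n⇒∣m+n (ℤ.∣n⇒∣m*n y d) (ℤ.∣n⇒∣m*n x′ e)))
    where
    regroup : ∀ x x′ y y′ → y * (x - x′) + x′ * (y - y′) ≡ x * y - x′ * y′
    regroup = solve-∀

  ℤ/p : CommutativeSemiring 0ℓ 0ℓ
  ℤ/p = record
    { Carrier = ℤ
    ; _≈_ = _≈_
    ; _+_ = _+_
    ; _*_ = _*_
    ; 0#  = 0ℤ
    ; 1#  = 1ℤ
    ; isCommutativeSemiring = IsCommutativeSemiringˡ.isCommutativeSemiring record
      { +-isCommutativeMonoid = IsCommutativeMonoidˡ.isCommutativeMonoid record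
        { isSemigroup = record
          { isMagma = record { isEquivalence = isEquivalence ; ∙-cong = +-cong }
          ; assoc = λ x y z → ≡⇒≈ (ℤ.+-assoc x y z)
          }
        ; identityˡ = λ x → ≡⇒≈ (ℤ.+-identityˡ x)
        ; comm = λ x y → ≡⇒≈ (ℤ.+-comm x y)
        }
      ; *-isCommutativeMonoid = IsCommutativeMonoidˡ.isCommutativeMonoid record
        { isSemigroup = record
          { isMagma = record { isEquivalence = isEquivalence ; ∙-cong = *-cong }
          ; assoc = λ x y z → ≡⇒≈ (ℤ.*-assoc x y z)
          }
        ; identityˡ = λ x → ≡⇒≈ (ℤ.*-identityˡ x)
        ; comm = λ x y → ≡⇒≈ (ℤ.*-comm x y)
        }
      ; distribʳ = λ x y z → ≡⇒≈ (ℤ.*-distribʳ-+ x y z)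
      ; zeroˡ = λ x → ≡⇒≈ (ℤ.*-zeroˡ x)
      }
    }
    where
    isEquivalence : IsEquivalence _≈_
    isEquivalence = record { refl = ≈-refl ; sym = ≈-sym ; trans = ≈-trans }

  ^-cong : ∀ {x y} n → x ≈ y → x ^ n ≈ y ^ n
  ^-cong zero    x≈y = ≈-refl
  ^-cong (suc n) x≈y = *-cong x≈y (^-cong n x≈y)

  ∣⇒≈0 : ∀ {x} → + p ℤ.∣ x → x ≈ 0ℤ
  ∣⇒≈0 {x} d = mk≈ (subst (+ p ℤ.∣_) (≡.sym (ℤ.+-identityʳ x)) d)

  ≈0⇒∣ : ∀ {x} → x ≈ 0ℤ → + p ℤ.∣ x
  ≈0⇒∣ {x} (mk≈ d) = subst (+ p ℤ.∣_) (ℤ.+-identityʳ x) d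

  ≈⇒-≈0 : ∀ {x y} → x ≈ y → x - y ≈ 0ℤ
  ≈⇒-≈0 = ∣⇒≈0 ∘ divides-difference

  -≈0⇒≈ : ∀ {x y} → x - y ≈ 0ℤ → x ≈ y
  -≈0⇒≈ = mk≈ ∘ ≈0⇒∣

  open CommutativeSemiring ℤ/p using (semiring; setoid)
  open Mult semiring using () renaming (_×_ to infixr 8 _·_)
  private module E = Exp semiring

  ×≡* : ∀ n x → n · x ≡ + n * x
  ×≡* zero    x = ≡.sym (ℤ.*-zeroˡ x)
  ×≡* (suc n) x = ≡.trans (cong (_+_ x) (×≡* n x)) (≡.sym (ℤ.suc-* (+ n) x))

  ^≡^ : ∀ x n → x E.^ n ≡ x ^ n
  ^≡^ x zero    = refl
  ^≡^ x (suc n) = cong (x *_) (^≡^ x n)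

  p×≈0 : ∀ x → p · x ≈ 0ℤ
  p×≈0 x = ≈-trans (≡⇒≈ (×≡* p x)) (∣⇒≈0 (ℤ.∣m⇒∣m*n x ℤ.∣-refl))

  small≉0 : ∀ {n} → 0 < n → n < p → ¬ + n ≈ 0ℤ
  small≉0 {suc n} _ n<p eq = ℕ.>⇒∤ n<p (ℤ.∣⇒∣ᵤ (≈0⇒∣ eq))

  module PrimeModulus (p-prime : Prime p) where

    instance
      p≢0 : ℕ.NonZero p
      p≢0 = prime⇒nonZero p-prime

    open import Relation.Binary.Reasoning.Setoid setoid

    *≈0 : ∀ x y → x * y ≈ 0ℤ → x ≈ 0ℤ ⊎ y ≈ 0ℤ
    *≈0 x y eq = [ inj₁ ∘ ∣⇒≈0 ∘ ℤ.∣ᵤ⇒∣ , inj₂ ∘ ∣⇒≈0 ∘ ℤ.∣ᵤ⇒∣ ]′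
      (euclidsLemma ℤ.∣ x ∣ ℤ.∣ y ∣ p-prime (subst (p ℕ.∣_) (ℤ.abs-* x y) (ℤ.∣⇒∣ᵤ (≈0⇒∣ eq))))

    1<p : 1 < p
    1<p = ℕ.nonTrivial⇒n>1 p {{prime⇒nonTrivial p-prime}}

    ^≉0 : ∀ {x} → ¬ x ≈ 0ℤ → ∀ n → ¬ x ^ n ≈ 0ℤ
    ^≉0     x≉0 zero    = small≉0 z<s 1<p
    ^≉0 {x} x≉0 (suc n) = [ x≉0 , ^≉0 x≉0 n ]′ ∘ *≈0 x (x ^ n)

    *-cancelˡ-≈0 : ∀ {x y} → ¬ x ≈ 0ℤ → x * y ≈ 0ℤ → y ≈ 0ℤ
    *-cancelˡ-≈0 {x} {y} x≉0 eq = [ ⊥-elim ∘ x≉0 , id ]′ (*≈0 x y eq)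

    *-cancelˡ-≈ : ∀ {x y z} → ¬ x ≈ 0ℤ → x * y ≈ x * z → y ≈ z
    *-cancelˡ-≈ {x} {y} {z} x≉0 eq = -≈0⇒≈ (*-cancelˡ-≈0 x≉0 (≈-trans (≡⇒≈ (distrib x y z)) (≈⇒-≈0 eq)))
      where
      distrib : ∀ x y z → x * (y - z) ≡ x * y - x * z
      distrib = solve-∀

    -- After reduction to a natural residue, induction with Frobenius applied to 1 + n.
    fermat : ∀ x → x ^ p ≈ x
    fermat x = begin
      x ^ p               ≈⟨ ^-cong p x≈r ⟩
      (+ r) ^ p           ≈⟨ natural r ⟩
      + r                 ≈⟨ x≈r ⟨
      x                   ∎
      where
      r = x ℤ.%ℕ p
      x≈r : x ≈ + r
      x≈r = mk≈ (ℤ.divides (x ℤ./ℕ p) (≡.trans (cong (_- + r) (ℤ.a≡a%ℕn+[a/ℕn]*n x p)) (cancel (+ r) (x ℤ./ℕ p * + p))))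
        where
        cancel : ∀ x y → x + y - x ≡ y
        cancel = solve-∀
      natural : ∀ n → (+ n) ^ p ≈ + n
      natural zero    = ≡⇒≈ (zero-^ p p≢0)
        where
        zero-^ : ∀ n → ℕ.NonZero n → 0ℤ ^ n ≡ 0ℤ
        zero-^ (suc n) _ = refl
      natural (suc n) = begin
        (+ suc n) ^ p             ≡⟨ ^≡^ (+ suc n) p ⟨
        (1ℤ + + n) E.^ p          ≈⟨ Frobenius.frobenius ℤ/p p-prime p×≈0 1ℤ (+ n) ⟩
        1ℤ E.^ p + (+ n) E.^ p    ≡⟨ cong₂ _+_ (^≡^ 1ℤ p) (^≡^ (+ n) p) ⟩
        1ℤ ^ p + (+ n) ^ p        ≈⟨ +-cong (≡⇒≈ (ℤ.^-zeroˡ p)) (natural n) ⟩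
        + suc n                   ∎

    -- Explains the exponent `p ∸ 2` of the matrix entries: they are reciprocals modulo `p`.
    fermat-inverse : ∀ {x} → ¬ x ≈ 0ℤ → x ^ (p ∸ 2) * x ≈ 1ℤ
    fermat-inverse {x} x≉0 = *-cancelˡ-≈ x≉0 (begin
      x * (x ^ (p ∸ 2) * x)     ≡⟨ reorder x (x ^ (p ∸ 2)) ⟩
      x ^ suc (suc (p ∸ 2))     ≡⟨ cong (x ^_) (ℕ.m+[n∸m]≡n 1<p) ⟩
      x ^ p                     ≈⟨ fermat x ⟩
      x                         ≡⟨ ℤ.*-identityʳ x ⟨
      x * 1ℤ                    ∎)
      where
      reorder : ∀ x y → x * (y * x) ≡ x * (x * y)
      reorder = solve-∀

    open Sum semiring using (sum; sum-cong-≗; *-distribˡ-sum; ∑-distrib-+)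

    -- The binomial factor makes induction on `e` possible: absorption trades one factor i for a
    -- step in `k` without increasing `e + k`. At `e = 0` the sum is `p C suc k`, a multiple of `p`.
    powerSumBinomial : ∀ e k → suc (e ℕ.+ k) < p → sum {p} (λ i → (+ toℕ i) ^ e * + (toℕ i C k)) ≈ 0ℤ
    powerSumBinomial zero    k k<p = begin
      sum {p} (λ i → 1ℤ * + (toℕ i C k))    ≡⟨ sum-cong-≗ {p} (λ i → ℤ.*-identityˡ (+ (toℕ i C k))) ⟩
      sum {p} (λ i → + (toℕ i C k))         ≡⟨ hockeyStick p k ⟩
      + (p C suc k)                         ≈⟨ ∣⇒≈0 (ℤ.∣ᵤ⇒∣ (prime∣pC p-prime k k<p)) ⟩
      0ℤ                                    ∎
    powerSumBinomial (suc e) k k<p = begin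
      sum {p} (λ i → (+ toℕ i) ^ suc e * + (toℕ i C k))
        ≡⟨ sum-cong-≗ {p} (λ i → step (toℕ i)) ⟩
      sum {p} (λ i → + suc k * W (suc k) i + + k * W k i)
        ≈⟨ ∑-distrib-+ {p} (λ i → + suc k * W (suc k) i) (λ i → + k * W k i) ⟩
      sum {p} (λ i → + suc k * W (suc k) i) + sum {p} (λ i → + k * W k i)
        ≈⟨ +-cong (*-distribˡ-sum (+ suc k) (W (suc k))) (*-distribˡ-sum (+ k) (W k)) ⟨
      + suc k * sum (W (suc k)) + + k * sum (W k)
        ≈⟨ +-cong (*-cong (≈-refl {+ suc k}) (powerSumBinomial e (suc k) (subst (_< p) (cong suc (≡.sym (ℕ.+-suc e k))) k<p)))
                  (*-cong (≈-refl {+ k}) (powerSumBinomial e k (ℕ.<-trans (ℕ.n<1+n _) k<p))) ⟩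
      + suc k * 0ℤ + + k * 0ℤ
        ≡⟨ cong₂ _+_ (ℤ.*-zeroʳ (+ suc k)) (ℤ.*-zeroʳ (+ k)) ⟩
      0ℤ ∎
      where
      W : ℕ → Fin p → ℤ
      W k i = (+ toℕ i) ^ e * + (toℕ i C k)
      step : ∀ i → (+ i) ^ suc e * + (i C k) ≡ + suc k * ((+ i) ^ e * + (i C suc k)) + + k * ((+ i) ^ e * + (i C k))
      step i = ≡.trans (reorder (+ i) ((+ i) ^ e) (+ (i C k))) (≡.trans
        (cong ((+ i) ^ e *_) absorb)
        (distrib ((+ i) ^ e) (+ suc k) (+ (i C suc k)) (+ k) (+ (i C k))))
        where
        reorder : ∀ x y z → x * y * z ≡ y * (x * z)
        reorder = solve-∀
        distrib : ∀ y a b c d → y * (a * b + c * d) ≡ a * (y * b) + c * (y * d)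
        distrib = solve-∀
        absorb : + i * + (i C k) ≡ + suc k * + (i C suc k) + + k * + (i C k)
        absorb = ≡.trans (≡.sym (ℤ.pos-* i (i C k))) (≡.trans (cong +_ (n*nCk≡[1+k]*nC[1+k]+k*nCk i k))
          (cong₂ _+_ (ℤ.pos-* (suc k) (i C suc k)) (ℤ.pos-* k (i C k))))

    powerSum : ∀ e → suc e < p → sum {p} (λ i → (+ toℕ i) ^ e) ≈ 0ℤ
    powerSum e e<p = ≈-trans
      (≡⇒≈ (sum-cong-≗ {p} λ i → ≡.sym (ℤ.*-identityʳ ((+ toℕ i) ^ e))))
      (powerSumBinomial e 0 (subst (_< p) (cong suc (≡.sym (ℕ.+-identityʳ e))) e<p))

-- Moments of the reciprocals of a quadratic form

^-distrib-* : ∀ x y n → (x * y) ^ n ≡ x ^ n * y ^ n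
^-distrib-* x y zero    = refl
^-distrib-* x y (suc n) = ≡.trans (cong (x * y *_) (^-distrib-* x y n)) (interchange x y (x ^ n) (y ^ n))
  where
  interchange : ∀ a b c d → a * b * (c * d) ≡ a * c * (b * d)
  interchange = solve-∀

module QuadraticForm (p : ℕ) (p-prime : Prime p) (c d : ℤ) where

  open Modular p
  open PrimeModulus p-prime
  open CommutativeSemiring ℤ/p using (semiring; setoid)
  open Sum semiring using (sum; sum-cong-≋; ∑-distrib-+; *-distribˡ-sum)

  module R = QuadraticExtension ℤ/p (- c) (- d)
  open R using (_≋_; _⊕_; _⊗_; ι; _,_; ≈₁; ≈₂)
  module Rₛ = CommutativeSemiring R.commutativeSemiring
  open Exp Rₛ.semiring public using () renaming (_^_ to infixr 8 _^ᴿ_; ^-congˡ to ^ᴿ-congˡ; ^-congʳ to ^ᴿ-congʳ)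

  p×≋0 : ∀ z → _
  p×≋0 z = Rₛ.trans (Rₛ.reflexive (R.×-pair p z)) (p×≈0 (proj₁ z) , p×≈0 (proj₂ z))

  open Frobenius R.commutativeSemiring p-prime p×≋0 public using (frobenius)

  ρ σ : ℤ × ℤ
  ρ = 0ℤ , 1ℤ
  σ = - c , -1ℤ

  -- The substitution of `σ`, that is - c - ρ, for `ρ`.
  conj : ℤ × ℤ → ℤ × ℤ
  conj (x , y) = x - c * y , - y

  ι-^p : ∀ x → ι x ^ᴿ p ≋ ι x
  ι-^p x = Rₛ.trans (R.ι-^ x p) (R.ι-cong (≈-trans (≡⇒≈ (^≡^ x p)) (fermat x)))

  -- Integer coefficients are fixed by Fermat, so only the image of `z` matters.
  frobenius-affine : ∀ x y z → (ι x ⊕ ι y ⊗ z) ^ᴿ p ≋ ι x ⊕ ι y ⊗ z ^ᴿ p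
  frobenius-affine x y z = begin
    (ι x ⊕ ι y ⊗ z) ^ᴿ p              ≈⟨ frobenius (ι x) (ι y ⊗ z) ⟩
    ι x ^ᴿ p ⊕ (ι y ⊗ z) ^ᴿ p         ≈⟨ Rₛ.+-cong (ι-^p x) (CExp.^-distrib-* R.commutativeSemiring (ι y) z p) ⟩
    ι x ⊕ ι y ^ᴿ p ⊗ z ^ᴿ p           ≈⟨ Rₛ.+-congˡ {ι x} (Rₛ.*-congʳ {z ^ᴿ p} (ι-^p y)) ⟩
    ι x ⊕ ι y ⊗ z ^ᴿ p                ∎
    where open import Relation.Binary.Reasoning.Setoid Rₛ.setoid

  Q : ℤ → ℤ → ℤ
  Q i j = i ^ 2 + c * i * j + d * j ^ 2

  -- Each of the three cases derives this hypothesis from its congruence condition on `p`.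
  module _ (ρ^p≋σ : ρ ^ᴿ p ≋ σ) where

    ^p≋conj : ∀ z → z ^ᴿ p ≋ conj z
    ^p≋conj z@(x , y) = begin
      z ^ᴿ p                     ≈⟨ ^ᴿ-congˡ p (≡⇒≈ (e₁ d x y) , ≡⇒≈ (e₂ c x y)) ⟩
      (ι x ⊕ ι y ⊗ ρ) ^ᴿ p       ≈⟨ frobenius-affine x y ρ ⟩
      ι x ⊕ ι y ⊗ ρ ^ᴿ p         ≈⟨ Rₛ.+-congˡ {ι x} (Rₛ.*-congˡ {ι y} ρ^p≋σ) ⟩
      ι x ⊕ ι y ⊗ σ              ≈⟨ (≡⇒≈ (e₃ c d x y) , ≡⇒≈ (e₄ c x y)) ⟩
      conj z                     ∎
      where
      open import Relation.Binary.Reasoning.Setoid Rₛ.setoid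
      e₁ : ∀ d x y → x ≡ x + (y * 0ℤ + - d * (0ℤ * 1ℤ))
      e₁ = solve-∀
      e₂ : ∀ c x y → y ≡ 0ℤ + (y * 1ℤ + 0ℤ * 0ℤ + - c * (0ℤ * 1ℤ))
      e₂ = solve-∀
      e₃ : ∀ c d x y → x + (y * - c + - d * (0ℤ * -1ℤ)) ≡ x - c * y
      e₃ = solve-∀
      e₄ : ∀ c x y → 0ℤ + (y * -1ℤ + 0ℤ * - c + - c * (0ℤ * -1ℤ)) ≡ - y
      e₄ = solve-∀

    -- z = conj (conj z) = (conj z)^p is divisible by conj z, so z ⊗ z is divisible by z ⊗ conj z.
    norm≋0⇒conj≋0 : ∀ z → z ⊗ conj z ≋ Rₛ.0# → conj z ≋ Rₛ.0#
    norm≋0⇒conj≋0 z@(x , y) N≋0 = begin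
      z̄                          ≈⟨ ^p≋conj z ⟨
      z ^ᴿ p                     ≈⟨ ^ᴿ-congʳ z p≡2+q ⟩
      z ^ᴿ (2 ℕ.+ q)             ≈⟨ Rₛ.*-assoc z z (z ^ᴿ q) ⟨
      z ⊗ z ⊗ z ^ᴿ q             ≈⟨ Rₛ.*-congʳ {z ^ᴿ q} z⊗z≋0 ⟩
      Rₛ.0# ⊗ z ^ᴿ q             ≈⟨ Rₛ.zeroˡ (z ^ᴿ q) ⟩
      Rₛ.0#                      ∎
      where
      open import Relation.Binary.Reasoning.Setoid Rₛ.setoid
      z̄ = conj z
      q = p ∸ 2
      p≡2+q : p ≡ 2 ℕ.+ q
      p≡2+q = ≡.sym (ℕ.m+[n∸m]≡n 1<p)
      e₁ : ∀ c x y → x ≡ x - c * y - c * - y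
      e₁ = solve-∀
      e₂ : ∀ y → y ≡ - - y
      e₂ = solve-∀
      z⊗z≋0 : z ⊗ z ≋ Rₛ.0#
      z⊗z≋0 = begin
        z ⊗ z                             ≈⟨ Rₛ.*-congˡ {z} (≡⇒≈ (e₁ c x y) , ≡⇒≈ (e₂ y)) ⟩
        z ⊗ conj z̄                        ≈⟨ Rₛ.*-congˡ {z} (^p≋conj z̄) ⟨
        z ⊗ z̄ ^ᴿ p                        ≈⟨ Rₛ.*-congˡ {z} (^ᴿ-congʳ z̄ p≡2+q) ⟩
        z ⊗ (z̄ ⊗ z̄ ^ᴿ (1 ℕ.+ q))          ≈⟨ Rₛ.*-assoc z z̄ (z̄ ^ᴿ (1 ℕ.+ q)) ⟨
        z ⊗ z̄ ⊗ z̄ ^ᴿ (1 ℕ.+ q)            ≈⟨ Rₛ.*-congʳ {z̄ ^ᴿ (1 ℕ.+ q)} N≋0 ⟩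
        Rₛ.0# ⊗ z̄ ^ᴿ (1 ℕ.+ q)            ≈⟨ Rₛ.zeroˡ (z̄ ^ᴿ (1 ℕ.+ q)) ⟩
        Rₛ.0#                             ∎

    -- `Q i j` is the norm of i - jρ, whose conjugate has second coordinate `j`; if the norm
    -- vanished, so would `j`.
    Q≉0 : ∀ i {j} → ¬ j ≈ 0ℤ → ¬ Q i j ≈ 0ℤ
    Q≉0 i {j} j≉0 Q≈0 = j≉0 (≈-trans (≡⇒≈ (≡.sym (ℤ.neg-involutive j)))
      (≈₂ (norm≋0⇒conj≋0 (i , - j) (≈-trans (≡⇒≈ (e₁ c d i j)) Q≈0 , ≡⇒≈ (e₂ c i j)))))
      where
      e₁ : ∀ c d i j → i * (i - c * - j) + - d * (- j * - - j) ≡ i * (i * 1ℤ) + c * i * j + d * (j * (j * 1ℤ))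
      e₁ = solve-∀
      e₂ : ∀ c i j → i * - - j + - j * (i - c * - j) + - c * (- j * - - j) ≡ 0ℤ
      e₂ = solve-∀

    module _ {j : ℤ} (j≉0 : ¬ j ≈ 0ℤ) where

      open import Relation.Binary.Reasoning.Setoid setoid

      j⁻¹ : ℤ
      j⁻¹ = j ^ (p ∸ 2)

      ratio : ℕ → ℤ
      ratio i = + i * j⁻¹

      f : ℕ → ℤ
      f i = entry p c d (+ i) j

      -- As 0 ^ 0 is 1, moment 0 includes the term i = 0; so the recurrence below starts at e = 0.
      moment : ℕ → ℤ
      moment e = sum {p} λ i → ratio (toℕ i) ^ e * f (toℕ i)

      -- For t = i/j the value t² + c t + d is Q/j², and `f i` is 1/Q. The defect of the recurrence
      -- is therefore iᵉ / jᵉ⁺², a pure power of i up to a constant.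
      moment-step-term : ∀ e i → ratio i ^ (2 ℕ.+ e) * f i ≈
        - c * (ratio i ^ (1 ℕ.+ e) * f i) + - d * (ratio i ^ e * f i) + j⁻¹ ^ e * (j⁻¹ * j⁻¹) * (+ i) ^ e
      moment-step-term e i = begin
        t ^ (2 ℕ.+ e) * f i
          ≡⟨ complete c d t (t ^ e) (f i) ⟩
        -- The factors `1ℤ` are places for `u`, which makes the quadratic homogeneous so that `Q`
        -- can be factored out.
        L + t ^ e * f i * (t * t + c * t * 1ℤ + d * (1ℤ * 1ℤ))
          ≈⟨ +-cong (≈-refl {L}) (*-cong (≈-refl {t ^ e * f i}) (+-cong (+-cong (≈-refl {t * t}) (*-cong (≈-refl {c * t}) inv)) (*-cong (≈-refl {d}) (*-cong inv inv)))) ⟨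
        L + t ^ e * f i * (t * t + c * t * u + d * (u * u))
          ≡⟨ cong (_+_ L) (factor c d (+ i) j j⁻¹ (t ^ e) (f i)) ⟩
        L + t ^ e * (j⁻¹ * j⁻¹) * (f i * Q (+ i) j)
          ≈⟨ +-cong (≈-refl {L}) (*-cong (≈-refl {t ^ e * (j⁻¹ * j⁻¹)}) (fermat-inverse (Q≉0 (+ i) j≉0))) ⟩
        L + t ^ e * (j⁻¹ * j⁻¹) * 1ℤ
          ≡⟨ cong (λ x → L + x * (j⁻¹ * j⁻¹) * 1ℤ) (^-distrib-* (+ i) j⁻¹ e) ⟩
        L + (+ i) ^ e * j⁻¹ ^ e * (j⁻¹ * j⁻¹) * 1ℤ
          ≡⟨ cong (_+_ L) (reorder ((+ i) ^ e) (j⁻¹ ^ e) (j⁻¹ * j⁻¹)) ⟩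
        L + j⁻¹ ^ e * (j⁻¹ * j⁻¹) * (+ i) ^ e ∎
        where
        t = ratio i
        u = j⁻¹ * j
        L = - c * (t ^ (1 ℕ.+ e) * f i) + - d * (t ^ e * f i)
        inv : u ≈ 1ℤ
        inv = fermat-inverse j≉0
        complete : ∀ c d t P f → t * (t * P) * f ≡ - c * (t * P * f) + - d * (P * f) + P * f * (t * t + c * t * 1ℤ + d * (1ℤ * 1ℤ))
        complete = solve-∀
        factor : ∀ c d i j j′ P f → P * f * (i * j′ * (i * j′) + c * (i * j′) * (j′ * j) + d * ((j′ * j) * (j′ * j)))
          ≡ P * (j′ * j′) * (f * (i * (i * 1ℤ) + c * i * j + d * (j * (j * 1ℤ))))
        factor = solve-∀
        reorder : ∀ a b c → a * b * c * 1ℤ ≡ b * c * a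
        reorder = solve-∀

      -- Summed over all residues, the pure power is killed by `powerSum`.
      moment-step : ∀ e → suc e < p → moment (2 ℕ.+ e) ≈ - c * moment (1 ℕ.+ e) + - d * moment e
      moment-step e e<p = begin
        moment (2 ℕ.+ e)
          ≈⟨ sum-cong-≋ {p} (moment-step-term e ∘ toℕ) ⟩
        sum {p} (λ i → - c * g 1 i + - d * g 0 i + K * h i)
          ≈⟨ ∑-distrib-+ {p} (λ i → - c * g 1 i + - d * g 0 i) (λ i → K * h i) ⟩
        sum {p} (λ i → - c * g 1 i + - d * g 0 i) + sum {p} (λ i → K * h i)
          ≈⟨ +-cong (∑-distrib-+ {p} (λ i → - c * g 1 i) (λ i → - d * g 0 i)) (≈-sym (*-distribˡ-sum {p} K h)) ⟩
        sum {p} (λ i → - c * g 1 i) + sum {p} (λ i → - d * g 0 i) + K * sum {p} h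
          ≈⟨ +-cong (+-cong (*-distribˡ-sum {p} (- c) (g 1)) (*-distribˡ-sum {p} (- d) (g 0)))
                    (*-cong (≈-refl {K}) (≈-sym (powerSum e e<p))) ⟨
        - c * moment (1 ℕ.+ e) + - d * moment e + K * 0ℤ
          ≡⟨ cong (_+_ (- c * moment (1 ℕ.+ e) + - d * moment e)) (ℤ.*-zeroʳ K) ⟩
        - c * moment (1 ℕ.+ e) + - d * moment e + 0ℤ
          ≡⟨ ℤ.+-identityʳ _ ⟩
        - c * moment (1 ℕ.+ e) + - d * moment e ∎
        where
        g : ℕ → Fin p → ℤ
        g k i = ratio (toℕ i) ^ (k ℕ.+ e) * f (toℕ i)
        K = j⁻¹ ^ e * (j⁻¹ * j⁻¹)
        h : Fin p → ℤ
        h i = (+ toℕ i) ^ e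

      -- The linear functional sending 1 and `ρ` to the first two moments.
      Λ : ℤ × ℤ → ℤ
      Λ (x , y) = x * moment 0 + y * moment 1

      Λ-cong : ∀ {z w} → z ≋ w → Λ z ≈ Λ w
      Λ-cong (x≈ , y≈) = +-cong (*-cong x≈ ≈-refl) (*-cong y≈ ≈-refl)

      Λ-ρρ : ∀ z → Λ (ρ ⊗ (ρ ⊗ z)) ≡ - c * Λ (ρ ⊗ z) + - d * Λ z
      Λ-ρρ (x , y) = expand c d x y (moment 0) (moment 1)
        where
        expand : ∀ c d x y s t →
          (0ℤ * (0ℤ * x + - d * (1ℤ * y)) + - d * (1ℤ * (0ℤ * y + 1ℤ * x + - c * (1ℤ * y)))) * s +
          (0ℤ * (0ℤ * y + 1ℤ * x + - c * (1ℤ * y)) + 1ℤ * (0ℤ * x + - d * (1ℤ * y)) + - c * (1ℤ * (0ℤ * y + 1ℤ * x + - c * (1ℤ * y)))) * t ≡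
          - c * ((0ℤ * x + - d * (1ℤ * y)) * s + (0ℤ * y + 1ℤ * x + - c * (1ℤ * y)) * t) + - d * (x * s + y * t)
        expand = solve-∀

      -- Consecutive values are paired because the recurrence has order two. The second component
      -- reaches the exponent `p` itself, where `moment-p` applies.
      moment≈Λρ^ : ∀ e → e < p → (moment e ≈ Λ (ρ ^ᴿ e)) × (moment (suc e) ≈ Λ (ρ ^ᴿ suc e))
      moment≈Λρ^ zero    _ = ≡⇒≈ (e₀ (moment 0) (moment 1)) , ≡⇒≈ (e₁ c d (moment 0) (moment 1))
        where
        e₀ : ∀ s t → s ≡ 1ℤ * s + 0ℤ * t
        e₀ = solve-∀
        e₁ : ∀ c d s t → t ≡ (0ℤ * 1ℤ + - d * (1ℤ * 0ℤ)) * s + (0ℤ * 0ℤ + 1ℤ * 1ℤ + - c * (1ℤ * 0ℤ)) * t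
        e₁ = solve-∀
      moment≈Λρ^ (suc e) e<p with ih₀ , ih₁ ← moment≈Λρ^ e (ℕ.<-trans (ℕ.n<1+n e) e<p) = ih₁ , (begin
        moment (2 ℕ.+ e)                                     ≈⟨ moment-step e e<p ⟩
        - c * moment (1 ℕ.+ e) + - d * moment e              ≈⟨ +-cong (*-cong (≈-refl { - c}) ih₁) (*-cong (≈-refl { - d}) ih₀) ⟩
        - c * Λ (ρ ^ᴿ (1 ℕ.+ e)) + - d * Λ (ρ ^ᴿ e)          ≡⟨ Λ-ρρ (ρ ^ᴿ e) ⟨
        Λ (ρ ^ᴿ (2 ℕ.+ e))                                   ∎)

      moment≈Λ : ∀ e → e ≤ p → moment e ≈ Λ (ρ ^ᴿ e)
      moment≈Λ zero    _   = proj₁ (moment≈Λρ^ 0 (ℕ.<-trans z<s 1<p))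
      moment≈Λ (suc e) e<p = proj₂ (moment≈Λρ^ e e<p)

      moment-p : moment p ≈ moment 1
      moment-p = sum-cong-≋ {p} λ i → *-cong
        (≈-trans (fermat (ratio (toℕ i))) (≡⇒≈ (≡.sym (ℤ.*-identityʳ (ratio (toℕ i))))))
        (≈-refl {f (toℕ i)})

      -- Moment `p` is computed twice: Fermat gives `moment 1`, and linearity gives `Λ σ`.
      c*moment₀ : c * moment 0 + + 2 * moment 1 ≈ 0ℤ
      c*moment₀ = begin
        c * moment 0 + + 2 * moment 1     ≡⟨ regroup c (moment 0) (moment 1) ⟩
        moment 1 - Λ σ                    ≈⟨ ≈⇒-≈0 (≈-trans (≈-sym moment-p) (≈-trans (moment≈Λ p ℕ.≤-refl) (Λ-cong ρ^p≋σ))) ⟩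
        0ℤ                                ∎
        where
        regroup : ∀ c s t → c * s + + 2 * t ≡ t - (- c * s + -1ℤ * t)
        regroup = solve-∀

      -- 2x - cy is the trace of x + yρ. Multiplied by the unit `c`, the functional `Λ` becomes a
      -- combination of this trace and the relation `c*moment₀`.
      moment-vanishes : ¬ c ≈ 0ℤ → ∀ {e x y} → e ≤ p → ρ ^ᴿ e ≋ (x , y) → + 2 * x ≈ c * y → moment e ≈ 0ℤ
      moment-vanishes c≉0 {e} {x} {y} e≤p ρ^e≋ 2x≈cy = ≈-trans (moment≈Λ e e≤p) (≈-trans (Λ-cong ρ^e≋) (*-cancelˡ-≈0 c≉0 (begin
        c * Λ (x , y)
          ≡⟨ regroup c x y (moment 0) (moment 1) ⟩
        x * (c * moment 0 + + 2 * moment 1) + - moment 1 * (+ 2 * x - c * y)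
          ≈⟨ +-cong (*-cong (≈-refl {x}) c*moment₀) (*-cong (≈-refl { - moment 1}) (≈⇒-≈0 2x≈cy)) ⟩
        x * 0ℤ + - moment 1 * 0ℤ
          ≡⟨ cong₂ _+_ (ℤ.*-zeroʳ x) (ℤ.*-zeroʳ (- moment 1)) ⟩
        0ℤ ∎)))
        where
        regroup : ∀ c x y s t → c * (x * s + y * t) ≡ x * (c * s + + 2 * t) + - t * (+ 2 * x - c * y)
        regroup = solve-∀

      -- Modulo `p`, i is `j` times its ratio, so the two sums differ by the factor `j ^ e`.
      columnSum-vanishes : ∀ {e} → moment e ≈ 0ℤ → sum {p} (λ i → (+ toℕ i) ^ e * f (toℕ i)) ≈ 0ℤ
      columnSum-vanishes {e} T≈0 = begin
        sum {p} (λ i → (+ toℕ i) ^ e * f (toℕ i))                   ≈⟨ sum-cong-≋ {p} (scale ∘ toℕ) ⟩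
        sum {p} (λ i → j ^ e * (ratio (toℕ i) ^ e * f (toℕ i)))     ≈⟨ *-distribˡ-sum {p} (j ^ e) (λ i → ratio (toℕ i) ^ e * f (toℕ i)) ⟨
        j ^ e * moment e                                            ≈⟨ *-cong (≈-refl {j ^ e}) T≈0 ⟩
        j ^ e * 0ℤ                                                  ≡⟨ ℤ.*-zeroʳ (j ^ e) ⟩
        0ℤ                                                          ∎
        where
        scale : ∀ i → (+ i) ^ e * f i ≈ j ^ e * (ratio i ^ e * f i)
        scale i = begin
          (+ i) ^ e * f i                    ≈⟨ *-cong (^-cong e (begin
            + i                                ≡⟨ ℤ.*-identityʳ (+ i) ⟨
            + i * 1ℤ                           ≈⟨ *-cong (≈-refl {+ i}) (fermat-inverse j≉0) ⟨
            + i * (j⁻¹ * j)                    ≡⟨ reorder (+ i) j⁻¹ j ⟩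
            j * ratio i                        ∎)) (≈-refl {f i}) ⟩
          (j * ratio i) ^ e * f i            ≡⟨ cong (_* f i) (^-distrib-* j (ratio i) e) ⟩
          j ^ e * ratio i ^ e * f i          ≡⟨ ℤ.*-assoc (j ^ e) (ratio i ^ e) (f i) ⟩
          j ^ e * (ratio i ^ e * f i)        ∎
          where
          reorder : ∀ a b c → a * (b * c) ≡ c * (a * b)
          reorder = solve-∀

    columnSums-vanish : ¬ c ≈ 0ℤ → ∀ {e x y} → e ≤ p → ρ ^ᴿ e ≋ (x , y) → + 2 * x ≈ c * y →
      ∀ {j} → ¬ j ≈ 0ℤ → sum {p} (λ i → (+ toℕ i) ^ e * entry p c d (+ toℕ i) j) ≈ 0ℤ
    columnSums-vanish c≉0 {e} e≤p ρ^e≋ 2x≈cy j≉0 =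
      columnSum-vanishes j≉0 {e} (moment-vanishes j≉0 c≉0 e≤p ρ^e≋ 2x≈cy)

-- A kernel vector of the submatrix

module SubmatrixKernel (m : ℕ) (p-prime : Prime (4 ℕ.+ m)) (c d : ℤ) where

  -- In this form `p ∸ 3` reduces to `suc m`, so the matrix visibly has a row 0.
  p : ℕ
  p = 4 ℕ.+ m

  open Modular p
  open PrimeModulus p-prime
  open CommutativeSemiring ℤ/p using (semiring; setoid)
  open Sum semiring using (sum; sum-cong-≋; ∑-distrib-+; *-distribˡ-sum)

  ColumnSumsVanish : ℕ → Set
  ColumnSumsVanish e = ∀ {j} → ¬ j ≈ 0ℤ → sum {p} (λ i → (+ toℕ i) ^ e * entry p c d (+ toℕ i) j) ≈ 0ℤ

  alt≈0 : ∀ {n} (v : Vector ℤ n) → (∀ j → v j ≈ 0ℤ) → alt v ≈ 0ℤ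
  alt≈0 {zero}  v v≈0 = ≈-refl
  alt≈0 {suc n} v v≈0 = ≈⇒-≈0 (≈-trans (v≈0 zero) (≈-sym (alt≈0 (v ∘ suc) (v≈0 ∘ suc))))

  -- Positive exponents make the weight vanish at i = 0, and equal parity at i = p - 1. The
  -- condition on powers of 2 makes the weight of the first row, i = 2, a unit.
  p∣D⁻ : ∀ e₁ e₂ → 0 < e₁ → 0 < e₂ → -1ℤ ^ e₁ ≡ -1ℤ ^ e₂ → ¬ (+ 2) ^ e₁ ≈ (+ 2) ^ e₂ →
    ColumnSumsVanish e₁ → ColumnSumsVanish e₂ → + p ℤ.∣ D⁻ p c d
  p∣D⁻ e₁@(suc _) e₂@(suc _) _ _ parity 2^e≉ van₁ van₂ =
    ≈0⇒∣ (*-cancelˡ-≈0 {u 2} (2^e≉ ∘ -≈0⇒≈) (≈-trans (≡⇒≈ (row₀*det M (λ i → u (2 ℕ.+ toℕ i))))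
      (alt≈0 (λ j → colSum j * det (minor₀ M j)) λ j → ≈-trans (*-cong (colSum≈0 j) (≈-refl {det (minor₀ M j)})) (≡⇒≈ (ℤ.*-zeroˡ (det (minor₀ M j)))))))
    where
    open import Relation.Binary.Reasoning.Setoid setoid
    M : Matrix (suc m)
    M i j = entry p c d (index i) (index j)
    u : ℕ → ℤ
    u i = (+ i) ^ e₁ - (+ i) ^ e₂
    colSum : Fin (suc m) → ℤ
    colSum j = ∑.sum (λ i → u (2 ℕ.+ toℕ i) * M i j)
    u[p-1]≈0 : u (3 ℕ.+ m) ≈ 0ℤ
    u[p-1]≈0 = ≈⇒-≈0 (begin
      (+ (3 ℕ.+ m)) ^ e₁     ≈⟨ ^-cong e₁ p-1≈-1 ⟩
      -1ℤ ^ e₁               ≡⟨ parity ⟩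
      -1ℤ ^ e₂               ≈⟨ ^-cong e₂ p-1≈-1 ⟨
      (+ (3 ℕ.+ m)) ^ e₂     ∎)
      where
      p-1≈-1 : + (3 ℕ.+ m) ≈ -1ℤ
      p-1≈-1 = mk≈ (ℤ.∣-reflexive (cong +_ (ℕ.+-comm 1 (3 ℕ.+ m))))
    colSum≈0 : ∀ j → colSum j ≈ 0ℤ
    colSum≈0 j = begin
      colSum j
        -- The rows 0, 1 and p - 1 are restored with weight zero, to reach the full sum over
        -- residues.
        ≡⟨ pad (colSum j) (entry p c d (+ 0) J) (entry p c d (+ 1) J) ⟩
      0ℤ * entry p c d (+ 0) J + (0ℤ * entry p c d (+ 1) J + (colSum j + 0ℤ))
        ≈⟨ +-cong (≈-refl {g 0}) (+-cong (*-cong (≡⇒≈ u₁≡0) (≈-refl {entry p c d (+ 1) J}))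
            (+-cong (≈-refl {colSum j}) (≈-trans (*-cong u[p-1]≈0 (≈-refl {g′})) (≡⇒≈ (ℤ.*-zeroˡ g′))))) ⟨
      g 0 + (g 1 + (colSum j + g (3 ℕ.+ m)))
        ≡⟨ cong (λ x → g 0 + (g 1 + x)) (sum-toℕ-suc (suc m) (λ i → g (2 ℕ.+ i))) ⟨
      sum {p} (g ∘ toℕ)
        ≈⟨ sum-cong-≋ {p} (λ i → ≡⇒≈ (split ((+ toℕ i) ^ e₁) ((+ toℕ i) ^ e₂) (entry p c d (+ toℕ i) J))) ⟩
      sum {p} (λ i → (+ toℕ i) ^ e₁ * h i + -1ℤ * ((+ toℕ i) ^ e₂ * h i))
        ≈⟨ ∑-distrib-+ {p} (λ i → (+ toℕ i) ^ e₁ * h i) (λ i → -1ℤ * ((+ toℕ i) ^ e₂ * h i)) ⟩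
      sum {p} (λ i → (+ toℕ i) ^ e₁ * h i) + sum {p} (λ i → -1ℤ * ((+ toℕ i) ^ e₂ * h i))
        ≈⟨ +-cong (van₁ J≉0)
                  (≈-trans (≈-sym (*-distribˡ-sum {p} -1ℤ (λ i → (+ toℕ i) ^ e₂ * h i)))
                    (*-cong (≈-refl { -1ℤ}) (van₂ J≉0))) ⟩
      0ℤ ∎
      where
      J = index j
      J≉0 : ¬ J ≈ 0ℤ
      J≉0 = small≉0 z<s (s<s (s<s (ℕ.<-trans (toℕ<n j) (ℕ.n<1+n (suc m)))))
      h : Fin p → ℤ
      h i = entry p c d (+ toℕ i) J
      g : ℕ → ℤ
      g i = u i * entry p c d (+ i) J
      g′ = entry p c d (+ (3 ℕ.+ m)) J
      u₁≡0 : u 1 ≡ 0ℤ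
      u₁≡0 = cong₂ _-_ (ℤ.^-zeroˡ e₁) (ℤ.^-zeroˡ e₂)
      pad : ∀ s a b → s ≡ 0ℤ * a + (0ℤ * b + (s + 0ℤ))
      pad = solve-∀
      split : ∀ a b x → (a - b) * x ≡ a * x + -1ℤ * (b * x)
      split = solve-∀

-- The three forms

module Case₂₂ {p : ℕ} (p-prime : Prime p) (k : ℕ) (p≡3+4k : p ≡ 3 ℕ.+ k ℕ.* 4) where

  open Modular p
  open QuadraticForm p p-prime (+ 2) (+ 2)
  open R using (_≋_; _⊕_; _⊗_; ι; _,_)

  -- Since ρ² + 2ρ + 2 = (ρ + 1)² + 1, the element 1 + ρ is a square root of -1.
  𝕚 𝕚̄ : ℤ × ℤ
  𝕚 = 1ℤ , 1ℤ
  𝕚̄ = -1ℤ , -1ℤ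

  𝕚^p≋𝕚̄ : 𝕚 ^ᴿ p ≋ 𝕚̄
  𝕚^p≋𝕚̄ = ^-mod R.commutativeSemiring 𝕚 4 3 k p≡3+4k (Rₛ.reflexive refl) (Rₛ.reflexive refl)

  ρ^p≋σ : ρ ^ᴿ p ≋ σ
  ρ^p≋σ = Rₛ.trans (frobenius-affine -1ℤ 1ℤ 𝕚) (Rₛ.+-congˡ {ι -1ℤ} (Rₛ.*-congˡ {ι 1ℤ} 𝕚^p≋𝕚̄))

module Case₃₃ {p : ℕ} (p-prime : Prime p) (k : ℕ) (p≡2+3k : p ≡ 2 ℕ.+ k ℕ.* 3) where

  open Modular p
  open QuadraticForm p p-prime (+ 3) (+ 3)
  open R using (_≋_; _⊕_; _⊗_; ι; _,_)

  -- Since ρ² + 3ρ + 3 = (ρ + 1)² + (ρ + 1) + 1, the element 1 + ρ is a cube root of unity, and `ω̄`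
  -- is its square.
  ω ω̄ : ℤ × ℤ
  ω = 1ℤ , 1ℤ
  ω̄ = - + 2 , -1ℤ

  ω^p≋ω̄ : ω ^ᴿ p ≋ ω̄
  ω^p≋ω̄ = ^-mod R.commutativeSemiring ω 3 2 k p≡2+3k (Rₛ.reflexive refl) (Rₛ.reflexive refl)

  ρ^p≋σ : ρ ^ᴿ p ≋ σ
  ρ^p≋σ = Rₛ.trans (frobenius-affine -1ℤ 1ℤ ω) (Rₛ.+-congˡ {ι -1ℤ} (Rₛ.*-congˡ {ι 1ℤ} ω^p≋ω̄))

module Case₃₁ {p : ℕ} (p-prime : Prime p) (k : ℕ) (p≡ : p ≡ 3 ℕ.+ k ℕ.* 20 ⊎ p ≡ 7 ℕ.+ k ℕ.* 20) where

  open Modular p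
  open PrimeModulus p-prime
  open QuadraticForm p p-prime (+ 3) (+ 1)
  open R using (_≋_; _⊕_; _⊗_; ι; _,_; ≈₁)

  -- ε is a root of x² = x + 1 and ρ = - ε².  The golden ratio ε equals 1 + ζ + ζ⁴ for
  -- a fifth root of unity ζ, which makes its Frobenius conjugate visible.
  ε ε̄ : ℤ × ℤ
  ε = -1ℤ , -1ℤ
  ε̄ = + 2 , 1ℤ

  -- ζ² = (ε - 1) ζ - 1, since ζ + ζ⁴ = ε - 1.
  module S = QuadraticExtension R.commutativeSemiring (- + 2 , -1ℤ) (ι -1ℤ)
  module Sₛ = CommutativeSemiring S.commutativeSemiring
  open Exp Sₛ.semiring using () renaming (_^_ to infixr 8 _^ˢ_)

  ζ : (ℤ × ℤ) × (ℤ × ℤ)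
  ζ = Rₛ.0# , Rₛ.1#

  -- Frobenius is additive and ζ⁵ = 1, so in ζ + ζ⁴ + 1 it replaces `ζ` by `ζ ^ˢ r`. For `r` equal
  -- to 2 or 3, the residues modulo 5 that occur, the last hypothesis is a closed computation.
  goldenConjugate : ∀ r k → p ≡ r ℕ.+ k ℕ.* 5 → ζ ^ˢ r S.⊕ (ζ ^ˢ 4) ^ˢ r S.⊕ Sₛ.1# ≡ S.ι ε̄ → ε ^ᴿ p ≋ ε̄
  goldenConjugate r k p≡r eq = S.≈₁ (begin
    S.ι (ε ^ᴿ p)                                      ≈⟨ S.ι-^ ε p ⟨
    (ζ S.⊕ ζ ^ˢ 4 S.⊕ Sₛ.1#) ^ˢ p                     ≈⟨ frobeniusˢ (ζ S.⊕ ζ ^ˢ 4) Sₛ.1# ⟩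
    (ζ S.⊕ ζ ^ˢ 4) ^ˢ p S.⊕ Sₛ.1# ^ˢ p                ≈⟨ Sₛ.+-cong (frobeniusˢ ζ (ζ ^ˢ 4)) (1^n≈1 S.commutativeSemiring p) ⟩
    ζ ^ˢ p S.⊕ (ζ ^ˢ 4) ^ˢ p S.⊕ Sₛ.1#
      ≈⟨ Sₛ.+-congʳ {Sₛ.1#} (Sₛ.+-cong (^-mod S.commutativeSemiring ζ 5 r k p≡r (Sₛ.reflexive refl) Sₛ.refl)
                                        (^-mod S.commutativeSemiring (ζ ^ˢ 4) 5 r k p≡r (Sₛ.reflexive refl) Sₛ.refl)) ⟩
    ζ ^ˢ r S.⊕ (ζ ^ˢ 4) ^ˢ r S.⊕ Sₛ.1#                ≡⟨ eq ⟩
    S.ι ε̄                                             ∎)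
    where
    open import Relation.Binary.Reasoning.Setoid Sₛ.setoid
    open Frobenius S.commutativeSemiring p-prime
      (λ z → Sₛ.trans (Sₛ.reflexive (S.×-pair p z)) (p×≋0 (proj₁ z) S., p×≋0 (proj₂ z)))
      renaming (frobenius to frobeniusˢ)

  ε^p≋ε̄ : ε ^ᴿ p ≋ ε̄
  ε^p≋ε̄ = [ (λ eq → goldenConjugate 3 (k ℕ.* 4) (≡.trans eq (cong (3 ℕ.+_) (≡.sym (ℕ.*-assoc k 4 5)))) refl)
           , (λ eq → goldenConjugate 2 (suc (k ℕ.* 4)) (≡.trans eq (cong (7 ℕ.+_) (≡.sym (ℕ.*-assoc k 4 5)))) refl) ]′ p≡

  ρ^p≋σ : ρ ^ᴿ p ≋ σ
  ρ^p≋σ = begin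
    (ι -1ℤ ⊕ ι -1ℤ ⊗ ε) ^ᴿ p      ≈⟨ frobenius-affine -1ℤ -1ℤ ε ⟩
    ι -1ℤ ⊕ ι -1ℤ ⊗ ε ^ᴿ p        ≈⟨ Rₛ.+-congˡ {ι -1ℤ} (Rₛ.*-congˡ {ι -1ℤ} ε^p≋ε̄) ⟩
    ι -1ℤ ⊕ ι -1ℤ ⊗ ε̄             ≡⟨⟩
    σ                             ∎
    where open import Relation.Binary.Reasoning.Setoid Rₛ.setoid

  p≡3[mod4] : ∃ λ l → p ≡ 3 ℕ.+ l ℕ.* 4
  p≡3[mod4] = [ (λ eq → k ℕ.* 5 , ≡.trans eq (cong (3 ℕ.+_) (≡.sym (ℕ.*-assoc k 5 4))))
            , (λ eq → suc (k ℕ.* 5) , ≡.trans eq (cong (7 ℕ.+_) (≡.sym (ℕ.*-assoc k 5 4)))) ]′ p≡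

  -- `h` is (p + 1)/4.
  l h : ℕ
  l = proj₁ p≡3[mod4]
  h = suc l

  p≡3+4l : p ≡ 3 ℕ.+ l ℕ.* 4
  p≡3+4l = proj₂ p≡3[mod4]

  h*3≤p : h ℕ.* 3 ≤ p
  h*3≤p = subst (h ℕ.* 3 ≤_) (≡.trans (split l) (≡.sym p≡3+4l)) (ℕ.m≤m+n (h ℕ.* 3) l)
    where
    split : ∀ l → suc l ℕ.* 3 ℕ.+ l ≡ 3 ℕ.+ l ℕ.* 4
    split = solveℕ-∀

  h≤p : h ≤ p
  h≤p = ℕ.≤-trans (ℕ.m≤m*n h 3) h*3≤p

  z : ℤ × ℤ
  z = ρ ^ᴿ h

  -- As ρ² = ε⁴, the square of `z` is ε to the power 4h = p + 1, hence the norm of the golden ratio.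
  z⊗z≋-1 : z ⊗ z ≋ ι -1ℤ
  z⊗z≋-1 = begin
    z ⊗ z                 ≈⟨ CExp.^-distrib-* R.commutativeSemiring ρ ρ h ⟨
    (ε ^ᴿ 4) ^ᴿ h         ≈⟨ Exp.^-assocʳ Rₛ.semiring ε 4 h ⟩
    ε ^ᴿ (4 ℕ.* h)        ≡⟨ cong (ε ^ᴿ_) (≡.trans (ℕ.*-comm 4 h) (cong suc (≡.sym p≡3+4l))) ⟩
    ε ⊗ ε ^ᴿ p            ≈⟨ Rₛ.*-congˡ {ε} ε^p≋ε̄ ⟩
    ε ⊗ ε̄                 ≡⟨⟩
    ι -1ℤ                 ∎
    where open import Relation.Binary.Reasoning.Setoid Rₛ.setoid

  z^2≋-1 : z ^ᴿ 2 ≋ ι -1ℤ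
  z^2≋-1 = Rₛ.trans (Rₛ.*-congˡ {z} (Rₛ.*-identityʳ z)) z⊗z≋-1

  z^3≋-z : z ^ᴿ 3 ≋ z ⊗ ι -1ℤ
  z^3≋-z = Rₛ.*-congˡ {z} z^2≋-1

  -- Conjugation is the `p`-th power, z⁴ = 1 and `p` is 3 modulo 4, so it sends `z` to z³ = - z.
  -- Thus `z` has trace zero, and so does z³.
  conj-z≋-z : conj z ≋ z ⊗ ι -1ℤ
  conj-z≋-z = begin
    conj z                    ≈⟨ ^p≋conj ρ^p≋σ z ⟨
    z ^ᴿ p                    ≈⟨ ^-mod R.commutativeSemiring z 4 3 l p≡3+4l z^4≋1 z^3≋-z ⟩
    z ⊗ ι -1ℤ                 ∎
    where
    open import Relation.Binary.Reasoning.Setoid Rₛ.setoid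
    z^4≋1 : z ^ᴿ 4 ≋ Rₛ.1#
    z^4≋1 = Rₛ.trans (Exp.^-homo-* Rₛ.semiring z 2 2) (Rₛ.*-cong z^2≋-1 z^2≋-1)

  trace-z : + 2 * proj₁ z ≈ + 3 * proj₂ z
  trace-z = -≈0⇒≈ (≈-trans (≡⇒≈ (regroup (proj₁ z) (proj₂ z))) (≈⇒-≈0 (≈₁ conj-z≋-z)))
    where
    regroup : ∀ x y → + 2 * x - + 3 * y ≡ (x - + 3 * y) - (x * -1ℤ + - + 1 * (y * 0ℤ))
    regroup = solve-∀

  trace-z^3 : + 2 * proj₁ (z ⊗ ι -1ℤ) ≈ + 3 * proj₂ (z ⊗ ι -1ℤ)
  trace-z^3 = ≈-trans (≡⇒≈ (e₁ (proj₁ z) (proj₂ z))) (≈-trans (*-cong (≈-refl { -1ℤ}) trace-z) (≡⇒≈ (e₂ (proj₁ z) (proj₂ z))))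
    where
    e₁ : ∀ x y → + 2 * (x * -1ℤ + - + 1 * (y * 0ℤ)) ≡ -1ℤ * (+ 2 * x)
    e₁ = solve-∀
    e₂ : ∀ x y → -1ℤ * (+ 3 * y) ≡ + 3 * (x * 0ℤ + y * -1ℤ + - + 3 * (y * 0ℤ))
    e₂ = solve-∀

  ρ^h*3 : ρ ^ᴿ (h ℕ.* 3) ≋ z ⊗ ι -1ℤ
  ρ^h*3 = Rₛ.trans (Rₛ.sym (Exp.^-assocʳ Rₛ.semiring ρ h 3)) z^3≋-z

  -- If w = 2ʰ satisfied w = w³, then w⁴ would be 1; but w⁴ is 2 to the power p + 1, which is 4 by
  -- Fermat.
  2^h≉2^[h*3] : 3 < p → ¬ (+ 2) ^ h ≈ (+ 2) ^ (h ℕ.* 3)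
  2^h≉2^[h*3] 3<p eq = small≉0 z<s 3<p (≈⇒-≈0 4≈1)
    where
    open import Relation.Binary.Reasoning.Setoid (CommutativeSemiring.setoid ℤ/p)
    w : ℤ
    w = (+ 2) ^ h
    w≉0 : ¬ w ≈ 0ℤ
    w≉0 = ^≉0 (small≉0 z<s (ℕ.<-trans (ℕ.n<1+n 2) 3<p)) h
    w²≈1 : w ^ 2 ≈ 1ℤ
    w²≈1 = ≈-sym (*-cancelˡ-≈ w≉0 (begin
      w * 1ℤ                 ≡⟨ ℤ.*-identityʳ w ⟩
      w                      ≈⟨ eq ⟩
      (+ 2) ^ (h ℕ.* 3)      ≡⟨ ℤ.^-*-assoc (+ 2) h 3 ⟨
      w * w ^ 2              ∎))
    4≈1 : + 4 ≈ + 1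
    4≈1 = begin
      + 2 * + 2              ≈⟨ *-cong (≈-refl {+ 2}) (fermat (+ 2)) ⟨
      (+ 2) ^ suc p          ≡⟨ cong (λ n → (+ 2) ^ suc n) p≡3+4l ⟩
      (+ 2) ^ (h ℕ.* 4)      ≡⟨ ℤ.^-*-assoc (+ 2) h 4 ⟨
      w ^ 4                  ≡⟨ ℤ.^-distribˡ-+-* w 2 2 ⟩
      w ^ 2 * w ^ 2          ≈⟨ *-cong w²≈1 w²≈1 ⟩
      + 1                    ∎

-- Choice of exponents in the three cases

theorem1p1 : (p : ℕ) → Prime p → 3 < p →
    (p % 8 ≡ 7 → + p ∣ D⁻ p (+ 2) (+ 2)) ×
    (5 < p → p % 3 ≡ 2 → + p ∣ D⁻ p (+ 3) (+ 3)) ×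
    (p % 20 ≡ 3 ⊎ p % 20 ≡ 7 → + p ∣ D⁻ p (+ 3) (+ 1))
theorem1p1 p p-prime 3<p with m , refl ← ℕ.m≤n⇒∃[o]m+o≡n 3<p = case₂₂ , case₃₃ , case₃₁
  where
  open Modular p
  open PrimeModulus p-prime
  open SubmatrixKernel m p-prime using (p∣D⁻)

  decompose : ∀ n {r} .{{_ : ℕ.NonZero n}} → p % n ≡ r → p ≡ r ℕ.+ p / n ℕ.* n
  decompose n eq = ≡.trans (m≡m%n+[m/n]*n p n) (cong (ℕ._+ p / n ℕ.* n) eq)

  2≉0 : ¬ + 2 ≈ 0ℤ
  2≉0 = small≉0 z<s (ℕ.<-trans (ℕ.n<1+n 2) 3<p)

  3≉0 : ¬ + 3 ≈ 0ℤ
  3≉0 = small≉0 z<s 3<p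

  case₂₂ : p % 8 ≡ 7 → + p ∣ D⁻ p (+ 2) (+ 2)
  -- With ρ = -1 + 𝕚, the powers ρ² = -2𝕚 and ρ⁶ = 8𝕚 have trace zero.
  case₂₂ p%8 = p∣D⁻ (+ 2) (+ 2) 2 6 z<s z<s refl 2²≉2⁶
    (columnSums-vanish ρ^p≋σ 2≉0 {2} (ℕ.≤-trans (ℕ.m≤m+n 2 5) 7≤p) (Rₛ.reflexive refl) ≈-refl)
    (columnSums-vanish ρ^p≋σ 2≉0 {6} (ℕ.≤-trans (ℕ.m≤m+n 6 1) 7≤p) (Rₛ.sym (Exp.^-assocʳ Rₛ.semiring ρ 2 3)) ≈-refl)
    where
    p≡7+8k = decompose 8 p%8
    open Case₂₂ p-prime (suc (p / 8 ℕ.* 2)) (≡.trans p≡7+8k (cong (7 ℕ.+_) (≡.sym (ℕ.*-assoc (p / 8) 2 4))))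
    open QuadraticForm p p-prime (+ 2) (+ 2)
    7≤p : 7 ≤ p
    7≤p = subst (7 ≤_) (≡.sym p≡7+8k) (ℕ.m≤m+n 7 _)
    2²≉2⁶ : ¬ + 4 ≈ + 64
    -- 64 - 4 = 4 · 3 · 5, and `p` is at least 7.
    2²≉2⁶ eq = [ small≉0 z<s (ℕ.≤-trans (ℕ.m≤m+n 5 2) 7≤p) , [ 3≉0 , small≉0 z<s (ℕ.≤-trans (ℕ.m≤m+n 6 1) 7≤p) ]′ ∘ *≈0 (+ 3) (+ 5) ]′
      (*≈0 (+ 4) (+ 15) (≈⇒-≈0 (≈-sym eq)))

  case₃₃ : 5 < p → p % 3 ≡ 2 → + p ∣ D⁻ p (+ 3) (+ 3)
  -- With ρ = ω - 1, ρ³ = 3(ω - ω²) changes sign under conjugation, and so does its cube ρ⁹.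
  case₃₃ 5<p p%3 = p∣D⁻ (+ 3) (+ 3) 3 9 z<s z<s refl 2³≉2⁹
    (columnSums-vanish ρ^p≋σ 3≉0 {3} (ℕ.<⇒≤ 3<p) (Rₛ.reflexive refl) ≈-refl)
    (columnSums-vanish ρ^p≋σ 3≉0 {9} (ℕ.<⇒≤ 9<p) (Rₛ.sym (Exp.^-assocʳ Rₛ.semiring ρ 3 3)) ≈-refl)
    where
    p≡2+3k = decompose 3 p%3
    open Case₃₃ p-prime (p / 3) p≡2+3k
    open QuadraticForm p p-prime (+ 3) (+ 3)
    -- The exponent 9 must not exceed `p`. Of the numbers 2, 5, 8, 11, ... the first two are
    -- excluded by 5 < p, and 8 is not prime.
    9<2+3k : ∀ k {q} → Prime q → 5 < q → q ≡ 2 ℕ.+ k ℕ.* 3 → 9 < q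
    9<2+3k 0 _ (s≤s (s≤s ())) refl
    9<2+3k 1 _ (s≤s (s≤s (s≤s (s≤s (s≤s ()))))) refl
    9<2+3k 2 8-prime _ refl = contradiction 8-prime (from-no (prime? 8))
    9<2+3k (suc (suc (suc k))) _ _ refl = ℕ.≤-trans (ℕ.m≤m+n 10 1) (ℕ.m≤m+n 11 (k ℕ.* 3))
    9<p : 9 < p
    9<p = 9<2+3k (p / 3) p-prime 5<p p≡2+3k
    2³≉2⁹ : ¬ + 8 ≈ + 512
    -- 512 - 8 = 8 · 7 · 9, and each factor is below `p`.
    2³≉2⁹ eq = [ small≉0 z<s (ℕ.≤-trans (ℕ.m≤m+n 9 1) 9<p) , [ small≉0 z<s (ℕ.≤-trans (ℕ.m≤m+n 8 2) 9<p) , small≉0 z<s 9<p ]′ ∘ *≈0 (+ 7) (+ 9) ]′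
      (*≈0 (+ 8) (+ 63) (≈⇒-≈0 (≈-sym eq)))

  case₃₁ : p % 20 ≡ 3 ⊎ p % 20 ≡ 7 → + p ∣ D⁻ p (+ 3) (+ 1)
  case₃₁ p%20 = p∣D⁻ (+ 3) (+ 1) h (h ℕ.* 3) z<s z<s parity (2^h≉2^[h*3] 3<p)
    (columnSums-vanish ρ^p≋σ 3≉0 {h} h≤p Rₛ.refl trace-z)
    (columnSums-vanish ρ^p≋σ 3≉0 {h ℕ.* 3} h*3≤p ρ^h*3 trace-z^3)
    where
    open Case₃₁ p-prime (p / 20) ([ inj₁ ∘ decompose 20 , inj₂ ∘ decompose 20 ]′ p%20)
    open QuadraticForm p p-prime (+ 3) (+ 1)
    parity : -1ℤ ^ h ≡ -1ℤ ^ (h ℕ.* 3)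
    -- The left side is read as `(-1ℤ ^ 3) ^ h`, because `-1ℤ ^ 3` computes to `-1ℤ`.
    parity = ≡.trans (ℤ.^-*-assoc -1ℤ 3 h) (cong (-1ℤ ^_) (ℕ.*-comm 3 h))
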